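{- Every $\mathit{LTL}^{\Box\bigcirc}_{\mathit{bool}}$ OMQ $\boldsymbol q=(\mathcal O,\psi(\boldsymbol t))$, where $\psi(\boldsymbol t)$ is an arbitrary $\mathrm{MFO}(<)$-formula, is $\mathrm{FO}(\mathrm{RPR})$-rewritable, and so $\mathrm{MSO}(<)$-rewritable.
   Context: Fix a countably infinite set of atomic concepts. An interpretation $\mathfrak M$ assigns to each atomic concept $A$ a set $A^{\mathfrak M}\subseteq\mathbb Z$. Basic temporal concepts $C::=A_i\mid\Box_F C\mid\Box_P C\mid\bigcirc_F C\mid\bigcirc_P C$ are interpreted by $(\Box_F C)^{\mathfrak M}=\{n\mid k\in C^{\mathfrak M}\ \forall k>n\}$, $(\Box_P C)^{\mathfrak M}=\{n\mid k\in C^{\mathfrak M}\ \forall k<n\}$, $(\bigcirc_F C)^{\mathfrak M}=\{n\mid n+1\in C^{\mathfrak M}\}$, $(\bigcirc_P C)^{\mathfrak M}=\{n\mid n-1\in C^{\mathfrak M}\}$. An $\mathit{LTL}^{\Box\bigcirc}_{\mathit{bool}}$ ontology $\mathcal O$ is a finite set of clauses $C_1\land\dots\land C_k\to C_{k+1}\lor\dots\lor C_{k+m}$, $k,m\ge0$, with basic temporal concepts $C_i$ (empty $\land$ is $\top$, empty $\lor$ is $\bot$); a clause is true in $\mathfrak M$ if $\bigcap_{i\le k}C_i^{\mathfrak M}\subseteq\bigcup_{j=1}^{m}C_{k+j}^{\mathfrak M}$ (empty $\bigcap$ is $\mathbb Z$, empty $\bigcup$ is $\emptyset$). A data instance $\mathcal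 A$ is a finite set of ground atoms $A_i(\ell)$, $\ell\in\mathbb Z$; it is assumed throughout that the least integer $\min\mathcal A$ occurring in it is $0$ and the greatest one satisfies $\max\mathcal A\ge1$; $\mathrm{tem}(\mathcal A)=\{n\in\mathbb Z\mid\min\mathcal A\le n\le\max\mathcal A\}$. $\mathfrak M$ is a model of $(\mathcal O,\mathcal A)$ if all clauses of $\mathcal O$ are true in $\mathfrak M$ and $\ell\in A^{\mathfrak M}$ for all $A(\ell)\in\mathcal A$. $\mathrm{MFO}(<)$-formulas are first-order formulas built from atoms $A(t)$ ($A$ an atomic concept), $(t<t')$ and the abbreviations $(t=t')$, $(t=t'+1)$; they are evaluated in interpretations $\mathfrak M$ as in first-order logic over the domain $(\mathbb Z,<)$. An OMQ is a pair $\boldsymbol q=(\mathcal O,\psi(\boldsymbol t))$, where $\boldsymbol t=(t_1,\dots,t_m)$, $m\ge0$, are the free variables of $\psi$. A tuple $\boldsymbol\ell$ in $\mathrm{tem}(\mathcal A)$ is a certain answer to $\boldsymbol q$ over $\mathcal A$ if $\mathfrak M\models\psi(\boldsymbol\ell)$ for every model $\mathfrak M$ of $(\mathcal O,\mathcal A)$; for $m=0$, $\boldsymbol q$ is entailed over $\mathcal A$ if $\mathfrak M\models\psi$ for every model $\mathfrak M$ of $(\mathcal O,\mathcal A)$. $\mathfrak S_{\mathcal A}$ is the finite first-order structure with domain $\mathrm{tem}(\mathcal A)$ ordered by $<$ in which $A(\ell)$ holds iff $A(\ell)\in\mathcal A$. For a class $\mathcal L$ of formulas, $\boldsymbol q$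 is $\mathcal L$-rewritable if there is an $\mathcal L$-formula $\boldsymbol Q(\boldsymbol t)$ such that, for every data instance $\mathcal A$ and every $m$-tuple $\boldsymbol\ell$ in $\mathrm{tem}(\mathcal A)$, $\boldsymbol\ell$ is a certain answer to $\boldsymbol q$ over $\mathcal A$ iff $\mathfrak S_{\mathcal A}\models\boldsymbol Q(\boldsymbol\ell)$ (for $m=0$: an $\mathcal L$-sentence $\boldsymbol Q$ with $\boldsymbol q$ entailed over $\mathcal A$ iff $\mathfrak S_{\mathcal A}\models\boldsymbol Q$). $\mathrm{MSO}(<)$-formulas are built from atoms $A(t)$ and $t<t'$ using the Booleans, first-order quantifiers, and second-order quantifiers over unary predicates. $\mathrm{FO}(\mathrm{RPR})$ extends first-order logic over the unary predicates and the successor relation with relational primitive recursion: if $\Theta_1,\dots,\Theta_n,\Psi$ are $\mathrm{FO}(\mathrm{RPR})$-formulas, one may form $$\big[\,Q_i(\boldsymbol z_i,t)\equiv\Theta_i(\boldsymbol z_i,t,Q_1(\boldsymbol z_1,t-1),\dots,Q_n(\boldsymbol z_n,t-1)),\ 1\le i\le n\,\big]\ \Psi(\boldsymbol z,\boldsymbol z_1,\dots,\boldsymbol z_n),$$ where the bracketed part defines the relations $Q_i$ used in $\Psi$ by recursion on $t=0,1,2,\dots$ in $\mathrm{tem}(\mathcal A)$, with all $Q_i(\boldsymbol z_i,-1)$ taken to be false; each relation variable $Q_i$ occurs in only one recursive definition. -}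

module Defs where

open import Level using (Lift; 0ℓ; _⊔_) renaming (suc to lsuc)
open import Data.Empty using (⊥)
open import Data.Fin using (Fin; splitAt)
open import Data.Integer using (ℤ; +_; -[1+_]; 0ℤ; 1ℤ; _+_; _-_; _≤_; _<_; +≤+)
open import Data.Integer.Properties using (≤-trans; i≤j⇒i≤1+j; ≤-refl)
open import Data.List using (List; map)
open import Data.List.Membership.Propositional using () renaming (_∈_ to _∈ˡ_)
open import Data.List.Relation.Unary.All using (All)
open import Data.List.Relation.Unary.Any using (Any)
open import Data.Nat using (ℕ; zero; suc; z≤n)
open import Data.Product using (Σ-syntax; ∃-syntax; _×_; _,_; proj₁; proj₂)
open import Data.Sum using (_⊎_; inj₁; inj₂)
open import Data.Vec using (Vec; []; _∷_; lookup) renaming (map to mapᵛ)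
open import Data.Vec.Functional using (Vector; _++_) renaming ([] to []ᶠ)
open import Function using (_∘_; _⇔_)
open import Relation.Binary.PropositionalEquality using (_≡_)
open import Relation.Nullary using (¬_)
open import Relation.Unary using (Pred; _∈_; _⊆_)

infix  25 _▷_
infix  20 _≐_ _≐_+1 _≺_ _∋_
infix  15 ∼_
infixr 12 _∧_
infixr 11 _∨_
infixr 10 _⇒_
infix   9 ∃′_ ∀′_

------------------------------------------------------------------------
-- Temporal concepts, ontologies and data instances

Atomic : Set
Atomic = ℕ

Interpretation : Set₁
Interpretation = Atomic → Pred ℤ 0ℓ

data Concept : Set where
  atom        : Atomic → Concept
  □F □P ○F ○P : Concept → Concept

⟦_⟧ : Concept → Interpretation → Pred ℤ 0ℓ
⟦ atom a ⟧ 𝔐 = 𝔐 a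
⟦ □F C ⟧   𝔐 = λ n → ∀ k → n < k → k ∈ ⟦ C ⟧ 𝔐
⟦ □P C ⟧   𝔐 = λ n → ∀ k → k < n → k ∈ ⟦ C ⟧ 𝔐
⟦ ○F C ⟧   𝔐 = λ n → n + 1ℤ ∈ ⟦ C ⟧ 𝔐
⟦ ○P C ⟧   𝔐 = λ n → n - 1ℤ ∈ ⟦ C ⟧ 𝔐

record Clause : Set where
  constructor _⟶_
  field
    body head : List Concept

TrueIn : Interpretation → Clause → Set
TrueIn 𝔐 (body ⟶ head) =
  (λ n → All (λ C → n ∈ ⟦ C ⟧ 𝔐) body) ⊆ (λ n → Any (λ C → n ∈ ⟦ C ⟧ 𝔐) head)

Ontology : Set
Ontology = List Clause

record DataInstance : Set where
  field
    facts : List (Atomic × ℤ)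
    max   : ℤ
  timestamps : List ℤ
  timestamps = map proj₂ facts
  field
    min-occurs : 0ℤ ∈ˡ timestamps
    min-least  : All (0ℤ ≤_) timestamps
    max-occurs : max ∈ˡ timestamps
    max-most   : All (_≤ max) timestamps
    1≤max      : 1ℤ ≤ max

open DataInstance

tem : DataInstance → Set
tem 𝒜 = Σ[ n ∈ ℤ ] (0ℤ ≤ n × n ≤ max 𝒜)

IsModel : Interpretation → Ontology → DataInstance → Set
IsModel 𝔐 𝒪 𝒜 = All (TrueIn 𝔐) 𝒪 × All (λ (a , ℓ) → ℓ ∈ 𝔐 a) (facts 𝒜)

------------------------------------------------------------------------
-- MFO(<), interpreted over (ℤ, <)

-- In all three logics, `v` bounds the number of free individual
-- variables, which are de Bruijn indices.

-- t ≐ t′ and t ≐ t′ +1 are definable from _≺_ over (ℤ, <).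
data MFO (v : ℕ) : Set where
  _▷_         : Atomic → Fin v → MFO v
  _≺_         : Fin v → Fin v → MFO v
  _≐_ _≐_+1   : Fin v → Fin v → MFO v
  ∼_          : MFO v → MFO v
  _∧_ _∨_ _⇒_ : MFO v → MFO v → MFO v
  ∃′_ ∀′_     : MFO (suc v) → MFO v

MFO-sat : ∀ {v} → Interpretation → Vec ℤ v → MFO v → Set
MFO-sat 𝔐 e (a ▷ t)      = lookup e t ∈ 𝔐 a
MFO-sat 𝔐 e (t ≺ t′)     = lookup e t < lookup e t′
MFO-sat 𝔐 e (t ≐ t′)     = lookup e t ≡ lookup e t′
MFO-sat 𝔐 e (t ≐ t′ +1)  = lookup e t ≡ lookup e t′ + 1ℤ
MFO-sat 𝔐 e (∼ φ)        = ¬ MFO-sat 𝔐 e φ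
MFO-sat 𝔐 e (φ ∧ χ)      = MFO-sat 𝔐 e φ × MFO-sat 𝔐 e χ
MFO-sat 𝔐 e (φ ∨ χ)      = MFO-sat 𝔐 e φ ⊎ MFO-sat 𝔐 e χ
MFO-sat 𝔐 e (φ ⇒ χ)      = MFO-sat 𝔐 e φ → MFO-sat 𝔐 e χ
MFO-sat 𝔐 e (∃′ φ)       = ∃[ n ] MFO-sat 𝔐 (n ∷ e) φ
MFO-sat 𝔐 e (∀′ φ)       = ∀ n → MFO-sat 𝔐 (n ∷ e) φ

------------------------------------------------------------------------
-- Ontology-mediated queries

record OMQ (m : ℕ) : Set where
  constructor ⟨_,_⟩
  field
    ontology : Ontology
    query    : MFO m

-- For m = 0 this is entailment of the OMQ over 𝒜.
CertainAnswer : ∀ {m} → OMQ m → (𝒜 : DataInstance) → Vec (tem 𝒜) m → Set₁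
CertainAnswer ⟨ 𝒪 , ψ ⟩ 𝒜 ℓs =
  ∀ 𝔐 → IsModel 𝔐 𝒪 𝒜 → MFO-sat 𝔐 (mapᵛ proj₁ ℓs) ψ

-- `L m` is the set of formulas with m free variables and `sat 𝒜 ℓs Q`
-- says that Q holds of ℓs in the finite structure 𝔖_𝒜.
Rewritable : ∀ {a} (L : ℕ → Set) →
             (∀ {m} (𝒜 : DataInstance) → Vec (tem 𝒜) m → L m → Set a) →
             ∀ {m} → OMQ m → Set (lsuc 0ℓ ⊔ a)
Rewritable L sat {m} q =
  ∃[ Q ] (∀ (𝒜 : DataInstance) (ℓs : Vec (tem 𝒜) m) →
          CertainAnswer q 𝒜 ℓs ⇔ sat 𝒜 ℓs Q)

------------------------------------------------------------------------
-- MSO(<), interpreted over 𝔖_𝒜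

-- `s` bounds the number of free set variables.
data MSO (s v : ℕ) : Set where
  _▷_         : Atomic → Fin v → MSO s v
  _∋_         : Fin s → Fin v → MSO s v
  _≺_         : Fin v → Fin v → MSO s v
  ∼_          : MSO s v → MSO s v
  _∧_ _∨_ _⇒_ : MSO s v → MSO s v → MSO s v
  ∃′_ ∀′_     : MSO s (suc v) → MSO s v
  ∃²_ ∀²_     : MSO (suc s) v → MSO s v

MSO-sat : ∀ {s v} (𝒜 : DataInstance) →
          Vec (Pred (tem 𝒜) 0ℓ) s → Vec (tem 𝒜) v → MSO s v → Set₁
MSO-sat 𝒜 E e (a ▷ t)  = Lift _ ((a , proj₁ (lookup e t)) ∈ˡ facts 𝒜)
MSO-sat 𝒜 E e (X ∋ t)  = Lift _ (lookup e t ∈ lookup E X)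
MSO-sat 𝒜 E e (t ≺ t′) = Lift _ (proj₁ (lookup e t) < proj₁ (lookup e t′))
MSO-sat 𝒜 E e (∼ φ)    = ¬ MSO-sat 𝒜 E e φ
MSO-sat 𝒜 E e (φ ∧ χ)  = MSO-sat 𝒜 E e φ × MSO-sat 𝒜 E e χ
MSO-sat 𝒜 E e (φ ∨ χ)  = MSO-sat 𝒜 E e φ ⊎ MSO-sat 𝒜 E e χ
MSO-sat 𝒜 E e (φ ⇒ χ)  = MSO-sat 𝒜 E e φ → MSO-sat 𝒜 E e χ
MSO-sat 𝒜 E e (∃′ φ)   = ∃[ d ] MSO-sat 𝒜 E (d ∷ e) φ
MSO-sat 𝒜 E e (∀′ φ)   = ∀ d → MSO-sat 𝒜 E (d ∷ e) φ
MSO-sat 𝒜 E e (∃² φ)   = ∃[ X ] MSO-sat 𝒜 (X ∷ E) e φ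
MSO-sat 𝒜 E e (∀² φ)   = ∀ X → MSO-sat 𝒜 (X ∷ E) e φ

MSO-Rewritable : ∀ {m} → OMQ m → Set₁
MSO-Rewritable = Rewritable (MSO 0) (λ 𝒜 → MSO-sat 𝒜 [])

------------------------------------------------------------------------
-- FO(RPR), interpreted over 𝔖_𝒜

-- Γ lists the arities of the relation variables in scope.  In
--
--   rec Δ Θ Ψ  =  [ Qᵢ(zᵢ, t) ≡ Θᵢ(zᵢ, t, Q₁(z₁, t-1), …, Qₙ(zₙ, t-1)) ] Ψ
--
-- Δ i is the length of zᵢ.
--
--   * In Θᵢ the recursion variable t is index 0, followed by zᵢ.  There
--     Qⱼ can only be used at t-1, so that Qⱼ(u, t-1) is written
--     `rel j u`, and Qⱼ has arity Δ j.
--   * In Ψ, Qⱼ(u, s) is written `rel j (s ∷ u)`, and Qⱼ has arity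
--     1 + Δ j.
--   * No relation variable bound further out occurs in Θᵢ, since a
--     relation variable occurs in only one recursive definition.
data FORPR : ∀ {r} → Vector ℕ r → ℕ → Set where
  _▷_         : ∀ {r v} {Γ : Vector ℕ r} → Atomic → Fin v → FORPR Γ v
  _≐_ _≐_+1   : ∀ {r v} {Γ : Vector ℕ r} → Fin v → Fin v → FORPR Γ v
  rel         : ∀ {r v} {Γ : Vector ℕ r} (j : Fin r) → Vec (Fin v) (Γ j) → FORPR Γ v
  ∼_          : ∀ {r v} {Γ : Vector ℕ r} → FORPR Γ v → FORPR Γ v
  _∧_ _∨_ _⇒_ : ∀ {r v} {Γ : Vector ℕ r} → FORPR Γ v → FORPR Γ v → FORPR Γ v
  ∃′_ ∀′_     : ∀ {r v} {Γ : Vector ℕ r} → FORPR Γ (suc v) → FORPR Γ v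
  rec         : ∀ {r v} {Γ : Vector ℕ r} {n} (Δ : Vector ℕ n)
                (Θ : (i : Fin n) → FORPR Δ (suc (Δ i)))
                (Ψ : FORPR ((suc ∘ Δ) ++ Γ) v) →
                FORPR Γ v

Relations : Set → ∀ {r} → Vector ℕ r → Set₁
Relations D {r} Γ = (j : Fin r) → Vec D (Γ j) → Set

_++ᴿ_ : ∀ {D r r′} {Γ : Vector ℕ r} {Γ′ : Vector ℕ r′} →
        Relations D Γ → Relations D Γ′ → Relations D (Γ ++ Γ′)
_++ᴿ_ {r = r} R R′ j with splitAt r j
... | inj₁ i = R i
... | inj₂ i = R′ i

module _ (𝒜 : DataInstance) {n} (Δ : Vector ℕ n)
         (step : Relations (tem 𝒜) Δ → Relations (tem 𝒜) (suc ∘ Δ)) where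

  -- stage k _ i z is Qᵢ(z, k); the relations Qⱼ(_, -1) are empty.
  stage : ∀ k → + k ≤ max 𝒜 → Relations (tem 𝒜) Δ
  stage zero    0≤max i z =
    step (λ _ _ → ⊥) i ((0ℤ , ≤-refl , 0≤max) ∷ z)
  stage (suc k) k<max i z =
    step (stage k (≤-trans (i≤j⇒i≤1+j ≤-refl) k<max)) i
         ((+ suc k , +≤+ z≤n , k<max) ∷ z)

  recursion : Relations (tem 𝒜) (suc ∘ Δ)
  recursion i ((+ k      , _  , k≤max) ∷ z) = stage k k≤max i z
  recursion i ((-[1+ _ ] , () , _) ∷ _)

FORPR-sat : ∀ {r v} {Γ : Vector ℕ r} (𝒜 : DataInstance) →
            Relations (tem 𝒜) Γ → Vec (tem 𝒜) v → FORPR Γ v → Set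
FORPR-sat 𝒜 R e (a ▷ t)     = (a , proj₁ (lookup e t)) ∈ˡ facts 𝒜
FORPR-sat 𝒜 R e (t ≐ t′)    = proj₁ (lookup e t) ≡ proj₁ (lookup e t′)
FORPR-sat 𝒜 R e (t ≐ t′ +1) = proj₁ (lookup e t) ≡ proj₁ (lookup e t′) + 1ℤ
FORPR-sat 𝒜 R e (rel j ts)  = R j (mapᵛ (lookup e) ts)
FORPR-sat 𝒜 R e (∼ φ)       = ¬ FORPR-sat 𝒜 R e φ
FORPR-sat 𝒜 R e (φ ∧ χ)     = FORPR-sat 𝒜 R e φ × FORPR-sat 𝒜 R e χ
FORPR-sat 𝒜 R e (φ ∨ χ)     = FORPR-sat 𝒜 R e φ ⊎ FORPR-sat 𝒜 R e χ
FORPR-sat 𝒜 R e (φ ⇒ χ)     = FORPR-sat 𝒜 R e φ → FORPR-sat 𝒜 R e χ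
FORPR-sat 𝒜 R e (∃′ φ)      = ∃[ d ] FORPR-sat 𝒜 R (d ∷ e) φ
FORPR-sat 𝒜 R e (∀′ φ)      = ∀ d → FORPR-sat 𝒜 R (d ∷ e) φ
FORPR-sat 𝒜 R e (rec Δ Θ Ψ) =
  FORPR-sat 𝒜 (recursion 𝒜 Δ (λ P i e′ → FORPR-sat 𝒜 P e′ (Θ i)) ++ᴿ R) e Ψ

FORPR-Rewritable : ∀ {m} → OMQ m → Set₁
FORPR-Rewritable = Rewritable (FORPR []ᶠ) (λ 𝒜 → FORPR-sat 𝒜 (λ ()))

{-# OPTIONS --safe #-}
module Submission where

-- Left-infinite words are split into finitely many classes, compatibly
-- with appending a letter, so that a word satisfies the given property iff
-- any word with an equivalent past and the same future does.  Excluded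
-- middle makes these classes available exactly, without any automaton for
-- infinite words: they exist for atomic formulas, are paired for the
-- Boolean connectives, and undergo a subset construction for quantifiers.
-- The existence of a model refuting the query is itself such a property of
-- the data, extended by the empty word on both sides.  Hence the class of
-- the prefix ending at t is determined by the letter at t and the class at
-- t - 1, which is a relational recursion, and an existential MSO formula
-- guesses and verifies the same sequence of classes.

open import Defs
open import Axiom.ExcludedMiddle using (ExcludedMiddle)
open import Data.Bool using (Bool; true; false)
open import Data.Empty using (⊥; ⊥-elim)
open import Data.Fin using (Fin; zero; suc; toℕ; fromℕ<; splitAt; _↑ˡ_; combine; funToFin; finToFun)
open import Data.Fin.Properties
  using (_≟_; toℕ-fromℕ<; splitAt-↑ˡ; combine-injectiveˡ; combine-injectiveʳ; finToFun-funToFin)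
open import Data.Integer using (ℤ; +_; -[1+_]; 0ℤ; 1ℤ; -1ℤ; _<_; _≤_; +≤+; +<+; -<+; -<-)
  renaming (suc to sucℤ; pred to predℤ; _+_ to _+ℤ_; _-_ to _-ℤ_)
import Data.Integer.Properties as ℤ
open import Data.List using (List; []; _∷_; map; foldr)
open import Data.List.Membership.Propositional using () renaming (_∈_ to _∈ˡ_)
open import Data.List.Membership.Propositional.Properties using (∈-map⁺)
open import Data.List.Relation.Unary.All as All using (All; []; _∷_)
open import Data.List.Relation.Unary.Any using (Any; here; there)
open import Data.Nat using (ℕ; zero; suc; _+_; _⊔_; s≤s; s<s; z<s; z≤n)
  renaming (_<_ to _<ℕ_; _*_ to _*ℕ_; _^_ to _^ℕ_)
import Data.Nat.Properties as ℕ
open import Data.Product using (Σ-syntax; ∃-syntax; _×_; _,_; proj₁; proj₂)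
open import Data.Product.Function.NonDependent.Propositional using (_×-⇔_)
open import Data.Sum using (_⊎_; inj₁; inj₂; [_,_])
open import Data.Sum.Function.Propositional using (_⊎-⇔_)
open import Data.Vec using (Vec; []; _∷_; lookup; tabulate; allFin) renaming (map to mapᵛ)
open import Data.Vec.Functional using (Vector; _++_) renaming ([] to []ᶠ)
open import Data.Vec.Properties using (lookup∘tabulate; map-∘; map-lookup-allFin)
open import Data.Vec.Relation.Binary.Pointwise.Inductive using (Pointwise; []; _∷_; tabulate⁺)
open import Function using (_∘_; _⇔_; mk⇔; Equivalence)
open import Function.Construct.Composition using (_⇔-∘_)
open import Function.Construct.Identity using (⇔-id)
open import Function.Construct.Symmetry using (⇔-sym)
open import Function.Related.TypeIsomorphisms using (→-cong-⇔; ¬-cong-⇔)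
open import Level using (Level; 0ℓ; lift; lower) renaming (suc to lsuc; _⊔_ to _⊔ℓ_)
open import Relation.Binary.Definitions using (tri<; tri≈; tri>)
open import Relation.Binary.PropositionalEquality using (_≡_; refl; sym; trans; cong; cong₂; subst; subst₂)
open import Relation.Nullary using (¬_; Dec; yes; no; contradiction; does; proof; ¬?)
open import Relation.Nullary.Decidable using (map′; decidable-stable)
open import Relation.Nullary.Reflects using (Reflects; ofʸ; ofⁿ)

open DataInstance
open Equivalence using (to; from)

private variable
  a b c ℓ ℓ′ : Level

-- Truth values and finite functions as elements of `Fin`

≡⇒⇔ : {A B : Set a} → A ≡ B → A ⇔ B
≡⇒⇔ refl = ⇔-id _

bit : {A : Set a} → Dec A → Fin 2
bit (yes _) = suc zero
bit (no _)  = zero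

bit-cong : {A : Set a} {B : Set b} (A? : Dec A) (B? : Dec B) → A ⇔ B → bit A? ≡ bit B?
bit-cong (yes _) (yes _) _   = refl
bit-cong (yes x) (no ¬y) A⇔B = contradiction (to A⇔B x) ¬y
bit-cong (no ¬x) (yes y) A⇔B = contradiction (from A⇔B y) ¬x
bit-cong (no _)  (no _)  _   = refl

bit-reflects : {A : Set a} {B : Set b} (A? : Dec A) (B? : Dec B) → bit A? ≡ bit B? → A → B
bit-reflects _       (yes y) _  _ = y
bit-reflects (yes _) (no _)  () _
bit-reflects (no ¬x) (no _)  _  x = contradiction x ¬x

funToFin-cong : ∀ {m n} {f g : Fin m → Fin n} → (∀ i → f i ≡ g i) → funToFin f ≡ funToFin g
funToFin-cong {zero}  f≗g = refl
funToFin-cong {suc m} f≗g = cong₂ combine (f≗g zero) (funToFin-cong (f≗g ∘ suc))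

-- Words over the integers and finite classes of their pasts

-- An interpretation is read as a ℤ-word over a countable set of tracks.

shift : Interpretation → Interpretation
shift W i n = W i (sucℤ n)

unshift : Interpretation → Interpretation
unshift W i n = W i (predℤ n)

splice : Interpretation → Interpretation → Interpretation
splice U V i (+ k)    = V i (+ k)
splice U V i -[1+ k ] = U i -[1+ k ]

_⊗_ : (ℤ → Set) → Interpretation → Interpretation
(Y ⊗ W) zero    = Y
(Y ⊗ W) (suc i) = W i

infix 4 _≈_ _≈⁻_ _≈⁺_
infixr 5 _⊗_

_≈_ _≈⁻_ _≈⁺_ : Interpretation → Interpretation → Set
W ≈  W′ = ∀ i n → W i n ⇔ W′ i n
W ≈⁻ W′ = ∀ i k → W i -[1+ k ] ⇔ W′ i -[1+ k ]
W ≈⁺ W′ = ∀ i k → W i (+ k) ⇔ W′ i (+ k)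

shift-unshift : ∀ W → shift (unshift W) ≈ W
shift-unshift W i n = ≡⇒⇔ (cong (W i) (ℤ.pred-suc n))

-- The class of a word depends on its part before 0 only.  The classes
-- form a finite right congruence which saturates P, so that no
-- acceptance condition for infinite words is needed.
record Regular (P : Interpretation → Set a) : Set (a ⊔ℓ lsuc 0ℓ) where
  field
    size width : ℕ
    state      : Interpretation → Fin size
    past       : ∀ W W′ → W ≈⁻ W′ → state W ≡ state W′
    step       : ∀ W W′ → state W ≡ state W′ →
                 (∀ i → i <ℕ width → W i 0ℤ ⇔ W′ i 0ℤ) →
                 state (shift W) ≡ state (shift W′)
    future     : ∀ W W′ → state W ≡ state W′ → W ≈⁺ W′ → P W → P W′
    invariant  : ∀ W → P W ⇔ P (shift W)

  future-⇔ : ∀ W W′ → state W ≡ state W′ → W ≈⁺ W′ → P W ⇔ P W′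
  future-⇔ W W′ eq W≈ = mk⇔ (future W W′ eq W≈) (future W′ W (sym eq) (λ i k → ⇔-sym (W≈ i k)))

  respects : ∀ W W′ → W ≈ W′ → P W → P W′
  respects W W′ W≈ = future W W′ (past W W′ (λ i k → W≈ i -[1+ k ])) (λ i k → W≈ i (+ k))

open Regular

-- Closure under Boolean connectives

regular-⇔ : {P : Interpretation → Set a} {Q : Interpretation → Set b} →
            (∀ W → P W ⇔ Q W) → Regular P → Regular Q
regular-⇔ P⇔Q p = record
  { size      = size p
  ; width     = width p
  ; state     = state p
  ; past      = past p
  ; step      = step p
  ; future    = λ W W′ eq W≈ → to (P⇔Q W′) ∘ future p W W′ eq W≈ ∘ from (P⇔Q W)
  ; invariant = λ W → P⇔Q (shift W) ⇔-∘ (invariant p W ⇔-∘ ⇔-sym (P⇔Q W))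
  }

-- The premise says that the truth value of `R` depends only on those of `P` and `Q`, so pairs of
-- classes suffice. Comparing `W` with `shift W` in the same way gives invariance.
regular-op : {P : Interpretation → Set a} {Q : Interpretation → Set b} {R : Interpretation → Set c} →
             (∀ W W′ → P W ⇔ P W′ → Q W ⇔ Q W′ → R W → R W′) →
             Regular P → Regular Q → Regular R
regular-op op p q = record
  { size      = size p *ℕ size q
  ; width     = width p ⊔ width q
  ; state     = λ W → combine (state p W) (state q W)
  ; past      = λ W W′ W≈ → cong₂ combine (past p W W′ W≈) (past q W W′ W≈)
  ; step      = λ W W′ eq W≈ → cong₂ combine
      (step p W W′ (left W W′ eq) (λ i i< → W≈ i (ℕ.<-≤-trans i< (ℕ.m≤m⊔n _ _))))
      (step q W W′ (right W W′ eq) (λ i i< → W≈ i (ℕ.<-≤-trans i< (ℕ.m≤n⊔m (width p) _))))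
  ; future    = λ W W′ eq W≈ → op W W′
      (future-⇔ p W W′ (left W W′ eq) W≈) (future-⇔ q W W′ (right W W′ eq) W≈)
  ; invariant = λ W → mk⇔
      (op W (shift W) (invariant p W) (invariant q W))
      (op (shift W) W (⇔-sym (invariant p W)) (⇔-sym (invariant q W)))
  }
  where
  left : ∀ W W′ → combine (state p W) (state q W) ≡ combine (state p W′) (state q W′) →
         state p W ≡ state p W′
  left W W′ = combine-injectiveˡ (state p W) (state q W) (state p W′) (state q W′)
  right : ∀ W W′ → combine (state p W) (state q W) ≡ combine (state p W′) (state q W′) →
          state q W ≡ state q W′
  right W W′ = combine-injectiveʳ (state p W) (state q W) (state p W′) (state q W′)

module _ {P : Interpretation → Set a} {Q : Interpretation → Set b} where

  regular-× : Regular P → Regular Q → Regular (λ W → P W × Q W)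
  regular-× = regular-op λ W W′ P⇔ Q⇔ → λ (x , y) → to P⇔ x , to Q⇔ y

  regular-⊎ : Regular P → Regular Q → Regular (λ W → P W ⊎ Q W)
  regular-⊎ = regular-op λ where
    W W′ P⇔ Q⇔ (inj₁ x) → inj₁ (to P⇔ x)
    W W′ P⇔ Q⇔ (inj₂ y) → inj₂ (to Q⇔ y)

  regular-→ : Regular P → Regular Q → Regular (λ W → P W → Q W)
  regular-→ = regular-op λ W W′ P⇔ Q⇔ f → to Q⇔ ∘ f ∘ from P⇔

regular-¬ : {P : Interpretation → Set a} → Regular P → Regular (λ W → ¬ P W)
regular-¬ p = regular-op (λ W W′ P⇔ _ ¬x → ¬x ∘ from P⇔) p p

-- Atomic properties

-- Variables will be singleton tracks. On these, membership and equality become `Meet`, the order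
-- becomes `Before`, and the successor is definable from `Before`.
Meet : ℕ → ℕ → Interpretation → Set
Meet i j W = ∃[ n ] (W i n × W j n)

Before : ℕ → ℕ → Interpretation → Set
Before i j W = ∃[ n ] ∃[ n′ ] (n < n′ × W i n × W j n′)

module Classical (em : ExcludedMiddle (lsuc 0ℓ)) where

  em₀ : {A : Set} → Dec A
  em₀ = map′ lower lift em

  -- Membership lives in `Set₁` because the sets of classes used for projection quantify over
  -- interpretations; hence the level of `em`.
  subset : ∀ {n} → (Fin n → Set₁) → Fin (2 ^ℕ n)
  subset S = funToFin (λ s → bit (em {S s}))

  subset-cong : ∀ {n} (S S′ : Fin n → Set₁) → (∀ s → S s ⇔ S′ s) → subset S ≡ subset S′
  subset-cong S S′ S⇔S′ = funToFin-cong (λ s → bit-cong em em (S⇔S′ s))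

  subset-injective : ∀ {n} (S S′ : Fin n → Set₁) → subset S ≡ subset S′ → ∀ s → S s → S′ s
  subset-injective S S′ eq s = bit-reflects em em
    (trans (sym (finToFun-funToFin (bit ∘ λ s → em {S s}) s))
      (trans (cong (λ k → finToFun k s) eq) (finToFun-funToFin (bit ∘ λ s → em {S′ s}) s)))

  -- One bit suffices: whether the tracks have met before 0. Equivalent words may have met at
  -- different places.
  regular-meet : ∀ i j → Regular (Meet i j)
  regular-meet i j = record
    { size      = 2
    ; width     = suc (i ⊔ j)
    ; state     = λ W → bit (em₀ {PastMeet W})
    ; past      = λ W W′ W≈ → bit-cong em₀ em₀ (mk⇔
        (λ (k , x , y) → k , to (W≈ i k) x , to (W≈ j k) y)
        (λ (k , x , y) → k , from (W≈ i k) x , from (W≈ j k) y))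
    ; step      = λ W W′ eq W≈ → bit-cong em₀ em₀ (mk⇔
        (stepMeet W W′ eq W≈) (stepMeet W′ W (sym eq) (λ l l< → ⇔-sym (W≈ l l<))))
    ; future    = futureMeet
    ; invariant = λ W → mk⇔
        (λ (n , x , y) → predℤ n , subst (W i) (sym (ℤ.suc-pred n)) x , subst (W j) (sym (ℤ.suc-pred n)) y)
        (λ (n , x , y) → sucℤ n , x , y)
    }
    where
    PastMeet : Interpretation → Set
    PastMeet W = ∃[ k ] (W i -[1+ k ] × W j -[1+ k ])

    stepMeet : ∀ W W′ → bit (em₀ {PastMeet W}) ≡ bit (em₀ {PastMeet W′}) →
               (∀ l → l <ℕ suc (i ⊔ j) → W l 0ℤ ⇔ W′ l 0ℤ) → PastMeet (shift W) → PastMeet (shift W′)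
    -- Position -1 after the shift is position 0 before it: the only case that reads the letter.
    stepMeet W W′ eq W≈ (zero , x , y) =
      zero , to (W≈ i (s≤s (ℕ.m≤m⊔n i j))) x , to (W≈ j (s≤s (ℕ.m≤n⊔m i j))) y
    stepMeet W W′ eq W≈ (suc k , x , y) with bit-reflects em₀ em₀ eq (k , x , y)
    ... | k′ , x′ , y′ = suc k′ , x′ , y′

    futureMeet : ∀ W W′ → bit (em₀ {PastMeet W}) ≡ bit (em₀ {PastMeet W′}) → W ≈⁺ W′ →
                 Meet i j W → Meet i j W′
    futureMeet W W′ eq W≈ (+ k , x , y) = + k , to (W≈ i k) x , to (W≈ j k) y
    futureMeet W W′ eq W≈ (-[1+ k ] , x , y) with bit-reflects em₀ em₀ eq (k , x , y)
    ... | k′ , x′ , y′ = -[1+ k′ ] , x′ , y′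

  -- Two bits suffice: whether track `i` has occurred, and whether a complete pair has. A pair
  -- straddling 0 needs only the first bit, since every past position precedes every later one.
  regular-before : ∀ i j → Regular (Before i j)
  regular-before i j = record
    { size      = 2 *ℕ 2
    ; width     = suc (i ⊔ j)
    ; state     = st
    ; past      = λ W W′ W≈ → cong₂ combine
        (bit-cong em₀ em₀ (mk⇔
          (λ (k , x) → k , to (W≈ i k) x)
          (λ (k , x) → k , from (W≈ i k) x)))
        (bit-cong em₀ em₀ (mk⇔
          (λ (k , l , l<k , x , y) → k , l , l<k , to (W≈ i k) x , to (W≈ j l) y)
          (λ (k , l , l<k , x , y) → k , l , l<k , from (W≈ i k) x , from (W≈ j l) y)))
    ; step      = λ W W′ eq W≈ → cong₂ combine
        (bit-cong em₀ em₀ (mk⇔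
          (stepOnce W W′ eq W≈) (stepOnce W′ W (sym eq) (λ l l< → ⇔-sym (W≈ l l<)))))
        (bit-cong em₀ em₀ (mk⇔
          (stepTwice W W′ eq W≈) (stepTwice W′ W (sym eq) (λ l l< → ⇔-sym (W≈ l l<)))))
    ; future    = futureBefore
    ; invariant = λ W → mk⇔
        (λ (n , n′ , n<n′ , x , y) → predℤ n , predℤ n′ , pred-mono-< n<n′ ,
          subst (W i) (sym (ℤ.suc-pred n)) x , subst (W j) (sym (ℤ.suc-pred n′)) y)
        (λ (n , n′ , n<n′ , x , y) → sucℤ n , sucℤ n′ , suc-mono-< n<n′ , x , y)
    }
    where
    pred-mono-< : ∀ {n n′} → n < n′ → predℤ n < predℤ n′
    pred-mono-< = ℤ.+-monoʳ-< -[1+ 0 ]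
    suc-mono-< : ∀ {n n′} → n < n′ → sucℤ n < sucℤ n′
    suc-mono-< = ℤ.+-monoʳ-< 1ℤ

    Once Twice : Interpretation → Set
    Once W  = ∃[ k ] W i -[1+ k ]
    -- Negative positions are counted backwards, so `-[1+ k ]` precedes `-[1+ l ]` exactly when
    -- `l <ℕ k`.
    Twice W = ∃[ k ] ∃[ l ] (l <ℕ k × W i -[1+ k ] × W j -[1+ l ])

    st : Interpretation → Fin (2 *ℕ 2)
    st W = combine (bit (em₀ {Once W})) (bit (em₀ {Twice W}))

    once : ∀ W W′ → st W ≡ st W′ → Once W → Once W′
    once W W′ eq = bit-reflects em₀ em₀ (combine-injectiveˡ _ (bit (em₀ {Twice W})) _ (bit (em₀ {Twice W′})) eq)

    twice : ∀ W W′ → st W ≡ st W′ → Twice W → Twice W′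
    twice W W′ eq = bit-reflects em₀ em₀ (combine-injectiveʳ (bit (em₀ {Once W})) _ (bit (em₀ {Once W′})) _ eq)

    module _ W W′ (eq : st W ≡ st W′) (W≈ : ∀ l → l <ℕ suc (i ⊔ j) → W l 0ℤ ⇔ W′ l 0ℤ) where

      stepOnce : Once (shift W) → Once (shift W′)
      stepOnce (zero , x) = zero , to (W≈ i (s≤s (ℕ.m≤m⊔n i j))) x
      stepOnce (suc k , x) with once W W′ eq (k , x)
      ... | k′ , x′ = suc k′ , x′

      stepTwice : Twice (shift W) → Twice (shift W′)
      -- The new letter completes a pair whose first element is older.
      stepTwice (suc k , zero , _ , x , y) with once W W′ eq (k , x)
      ... | k′ , x′ = suc k′ , zero , z<s , x′ , to (W≈ j (s≤s (ℕ.m≤n⊔m i j))) y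
      stepTwice (suc k , suc l , s≤s l<k , x , y) with twice W W′ eq (k , l , l<k , x , y)
      ... | k′ , l′ , l<k′ , x′ , y′ = suc k′ , suc l′ , s<s l<k′ , x′ , y′

    futureBefore : ∀ W W′ → st W ≡ st W′ → W ≈⁺ W′ → Before i j W → Before i j W′
    futureBefore W W′ eq W≈ (+ k , + l , k<l , x , y) = + k , + l , k<l , to (W≈ i k) x , to (W≈ j l) y
    futureBefore W W′ eq W≈ (-[1+ k ] , + l , _ , x , y) with once W W′ eq (k , x)
    ... | k′ , x′ = -[1+ k′ ] , + l , -<+ , x′ , to (W≈ j l) y
    futureBefore W W′ eq W≈ (-[1+ k ] , -[1+ l ] , -<- l<k , x , y) with twice W W′ eq (k , l , l<k , x , y)
    ... | k′ , l′ , l<k′ , x′ , y′ = -[1+ k′ ] , -[1+ l′ ] , -<- l<k′ , x′ , y′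

  -- Projection and first-order quantifiers

  -- Projection along a relation ρ between columns, by a subset
  -- construction on the classes.
  module _ (ρ : (ℕ → Set) → (ℕ → Set) → Set)
           (ρ-resp : ∀ x x′ w → (∀ i → x i ⇔ x′ i) → ρ x w → ρ x′ w) where

    Related : Interpretation → Interpretation → ℤ → Set
    Related X W n = ρ (λ i → X i n) (λ i → W i n)

    -- The class of `X` is the set of classes of words whose past is related to that of `X`. Letters
    -- are compared on finitely many tracks only, so the premise asks that a column related to `x`
    -- can be rebuilt over any `x′` agreeing with `x` there, without changing what `p` reads.
    regular-∃ : {P : Interpretation → Set a} (p : Regular P) →
      (∀ x x′ w → (∀ i → i <ℕ width p → x i ⇔ x′ i) → ρ x w →
         ∃[ w′ ] (ρ x′ w′ × (∀ i → i <ℕ width p → w i ⇔ w′ i))) →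
      Regular (λ X → ∃[ W ] ((∀ n → Related X W n) × P W))
    regular-∃ {P = P} p ρ-lift = record
      { size      = 2 ^ℕ size p
      ; width     = width p
      ; state     = λ X → subset (Reach X)
      ; past      = λ X X′ X≈ → subset-cong (Reach X) (Reach X′) λ s → mk⇔
          (λ (W , related , eq) → W , (λ k → ρ-resp _ _ _ (λ i → X≈ i k) (related k)) , eq)
          (λ (W , related , eq) → W , (λ k → ρ-resp _ _ _ (λ i → ⇔-sym (X≈ i k)) (related k)) , eq)
      ; step      = λ X X′ eq X≈ → subset-cong (Reach (shift X)) (Reach (shift X′)) λ s → mk⇔
          (step-reach X X′ eq X≈ s) (step-reach X′ X (sym eq) (λ i i< → ⇔-sym (X≈ i i<)) s)
      ; future    = λ X X′ eq X≈ (W , related , PW) → future-∃ X X′ eq X≈ W related PW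
      ; invariant = λ X → mk⇔
          (λ (W , related , PW) → shift W , related ∘ sucℤ , to (invariant p W) PW)
          (λ (W , related , PW) → unshift W ,
            (λ n → ρ-resp _ _ _ (λ i → ≡⇒⇔ (cong (X i) (ℤ.suc-pred n))) (related (predℤ n))) ,
            from (invariant p (unshift W)) (respects p _ _ (λ i n → ⇔-sym (shift-unshift W i n)) PW))
      }
      where
      Reach : Interpretation → Fin (size p) → Set₁
      Reach X s = ∃[ W ] ((∀ k → Related X W -[1+ k ]) × state p W ≡ s)

      step-reach : ∀ X X′ → subset (Reach X) ≡ subset (Reach X′) →
                   (∀ i → i <ℕ width p → X i 0ℤ ⇔ X′ i 0ℤ) →
                   ∀ s → Reach (shift X) s → Reach (shift X′) s
      -- Moving `W` one step back gives a past related to that of `X`; equality of the subsets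
      -- replaces it by some `V` over `X′` of the same class, and the premise supplies the missing
      -- column at 0.
      step-reach X X′ eq X≈ s (W , related , refl)
        with subset-injective (Reach X) (Reach X′) eq _ (unshift W , related ∘ suc , refl)
      ... | V , relV , eqV with ρ-lift _ (λ i → X′ i 0ℤ) _ X≈ (related 0)
      ... | w′ , relw′ , w≈w′ = shift G , relG , trans
              (step p G (unshift W) (trans (past p G V (λ i k → ⇔-id _)) eqV) (λ i i< → ⇔-sym (w≈w′ i i<)))
              (past p _ _ (λ i k → shift-unshift W i _))
        where
        G : Interpretation
        -- The column is repeated at all later positions, but the step reads only its copy at 0.
        G = splice V (λ i _ → w′ i)
        relG : ∀ k → Related (shift X′) (shift G) -[1+ k ]
        relG zero    = relw′
        relG (suc k) = relV k

      -- The witness takes its past from a word over `X′` in the class of `W`, and the rest from `W`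
      -- itself.
      future-∃ : ∀ X X′ → subset (Reach X) ≡ subset (Reach X′) → X ≈⁺ X′ →
                 ∀ W → (∀ n → Related X W n) → P W → ∃[ W′ ] ((∀ n → Related X′ W′ n) × P W′)
      future-∃ X X′ eq X≈ W related PW with subset-injective (Reach X) (Reach X′) eq _ (W , (λ k → related -[1+ k ]) , refl)
      ... | V , relV , eqV = splice V W , relG ,
            future p W _ (trans (sym eqV) (past p _ _ (λ i k → ⇔-id _))) (λ i k → ⇔-id _) PW
        where
        relG : ∀ n → Related X′ (splice V W) n
        relG (+ k)    = ρ-resp _ _ _ (λ i → X≈ i k) (related (+ k))
        relG -[1+ k ] = relV k

  private
    Extends : (ℕ → Set) → (ℕ → Set) → Set
    Extends x w = ∀ i → w (suc i) ⇔ x i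

    Singleton : Interpretation → Set
    Singleton W = Meet 0 0 W × ¬ Before 0 0 W

    singleton-unique : ∀ W → ¬ Before 0 0 W → ∀ {n n′} → W 0 n → W 0 n′ → n′ ≡ n
    singleton-unique W ¬two {n} {n′} x y with ℤ.<-cmp n n′
    ... | tri< n<n′ _ _ = contradiction (n , n′ , n<n′ , x , y) ¬two
    ... | tri≈ _ n≡n′ _ = sym n≡n′
    ... | tri> _ _ n′<n = contradiction (n′ , n , n′<n , y , x) ¬two

  -- A first-order quantifier projects away track 0 restricted to singletons: `Meet 0 0` makes the
  -- track inhabited and `¬ Before 0 0` forbids two distinct elements.
  regular-∃₁ : {P : Interpretation → Set a} → Regular P → Regular (λ W → ∃[ n ] P ((_≡ n) ⊗ W))
  regular-∃₁ {P = P} p = regular-⇔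
    {P = λ X → ∃[ W ] ((∀ n → Extends (λ i → X i n) (λ i → W i n)) × (Singleton W × P W))} (λ X → mk⇔
      (λ (W , ext , ((n , x , _) , ¬two) , PW) → n , respects p W _ (λ where
         zero    n′ → mk⇔ (singleton-unique W ¬two x) (λ { refl → x })
         (suc i) n′ → ext n′ i) PW)
      (λ (n , PW) → (_≡ n) ⊗ X , (λ _ _ → ⇔-id _) ,
        ((n , refl , refl) , λ { (m , m′ , m<m′ , refl , refl) → ℤ.<-irrefl refl m<m′ }) , PW))
    (regular-∃ Extends (λ x x′ w x≈ ext i → x≈ i ⇔-∘ ext i)
      (regular-× (regular-× (regular-meet 0 0) (regular-¬ (regular-before 0 0))) p)
      -- Track 0 is kept and the others are copied from `x′`. Track `suc i` of the new column is
      -- track `i` of `x′`, so agreement below the same width is enough.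
      λ x x′ w x≈ ext → (λ { zero → w zero ; (suc i) → x′ i }) , (λ i → ⇔-id _) , λ where
        zero    _  → ⇔-id _
        (suc i) i< → x≈ i (ℕ.<-trans (ℕ.n<1+n i) i<) ⇔-∘ ext i)

  regular-∀₁ : {P : Interpretation → Set} → Regular P → Regular (λ W → ∀ n → P ((_≡ n) ⊗ W))
  regular-∀₁ p = regular-⇔ (λ _ → mk⇔
      (λ ¬∃ n → decidable-stable em₀ (λ ¬x → ¬∃ (n , ¬x)))
      (λ all (n , ¬x) → ¬x (all n)))
    (regular-¬ (regular-∃₁ (regular-¬ p)))

-- First-order formulas as properties of words

-- The value of the i-th individual variable is the only element of track
-- i, and the atomic concepts occupy the remaining tracks.
encode : ∀ {v} → Vec ℤ v → Interpretation → Interpretation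
encode []      𝔐 = 𝔐
encode (n ∷ e) 𝔐 = (_≡ n) ⊗ encode e 𝔐

encode-lookup : ∀ {v} (e : Vec ℤ v) 𝔐 t n → encode e 𝔐 (toℕ t) n ⇔ n ≡ lookup e t
encode-lookup (_ ∷ e) 𝔐 zero    n = ⇔-id _
encode-lookup (_ ∷ e) 𝔐 (suc t) n = encode-lookup e 𝔐 t n

encode-atomic : ∀ {v} (e : Vec ℤ v) 𝔐 a n → encode e 𝔐 (v + a) n ⇔ 𝔐 a n
encode-atomic []      𝔐 a n = ⇔-id _
encode-atomic (_ ∷ e) 𝔐 a n = encode-atomic e 𝔐 a n

encode-mono : ∀ {v} (e : Vec ℤ v) {𝔐 𝔑 : Interpretation} → (∀ a n → 𝔐 a n → 𝔑 a n) →
              ∀ i n → encode e 𝔐 i n → encode e 𝔑 i n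
encode-mono []      𝔐⊆𝔑 i       n = 𝔐⊆𝔑 i n
encode-mono (_ ∷ e) 𝔐⊆𝔑 zero    n = λ eq → eq
encode-mono (_ ∷ e) 𝔐⊆𝔑 (suc i) n = encode-mono e 𝔐⊆𝔑 i n

encode-variable : ∀ {v} (e : Vec ℤ v) 𝔐 𝔑 i n → i <ℕ v → encode e 𝔐 i n → encode e 𝔑 i n
encode-variable (_ ∷ e) 𝔐 𝔑 zero    n _         = λ eq → eq
encode-variable (_ ∷ e) 𝔐 𝔑 (suc i) n (s<s i<v) = encode-variable e 𝔐 𝔑 i n i<v

-- Turns a word found by projection back into an interpretation: once the first `v` tracks are those
-- prescribed by `e`, the others are read as concepts.
encode-decode : ∀ {v} (e : Vec ℤ v) 𝔑 W → (∀ i → i <ℕ v → ∀ n → W i n ⇔ encode e 𝔑 i n) →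
                W ≈ encode e (λ a → W (v + a))
encode-decode []      𝔑 W W≈ i       n = ⇔-id _
encode-decode (_ ∷ e) 𝔑 W W≈ zero    n = W≈ zero z<s n
encode-decode (_ ∷ e) 𝔑 W W≈ (suc i) n =
  encode-decode e 𝔑 (W ∘ suc) (λ j j<v → W≈ (suc j) (s<s j<v)) i n

i<1+i : ∀ i → i < sucℤ i
i<1+i i = ℤ.suc[i]≤j⇒i<j ℤ.≤-refl

i+1≡suc : ∀ i → i +ℤ 1ℤ ≡ sucℤ i
i+1≡suc i = ℤ.+-comm i 1ℤ

adjacent : ∀ {i j} → i < j → ¬ sucℤ i < j → j ≡ sucℤ i
adjacent {i} {j} i<j ¬between with ℤ.<-cmp j (sucℤ i)
... | tri< j<si _ _ = contradiction (ℤ.i<j⇒suc[i]≤j i<j) (ℤ.<⇒≱ j<si)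
... | tri≈ _ eq _   = eq
... | tri> _ _ si<j = contradiction si<j ¬between

⟪_⟫ : ∀ {v} → MFO v → Interpretation → Set
⟪_⟫ {v} (a ▷ t) W = Meet (toℕ t) (v + a) W
⟪ t ≺ t′ ⟫      W = Before (toℕ t) (toℕ t′) W
⟪ t ≐ t′ ⟫      W = Meet (toℕ t) (toℕ t′) W
-- Nothing lies strictly between. The intermediate position occupies track 0 and moves the other
-- variables up by one.
⟪ t ≐ t′ +1 ⟫   W = Before (toℕ t′) (toℕ t) W ×
  ¬ (∃[ n ] (Before (toℕ (suc t′)) 0 ((_≡ n) ⊗ W) × Before 0 (toℕ (suc t)) ((_≡ n) ⊗ W)))
⟪ ∼ φ ⟫         W = ¬ ⟪ φ ⟫ W
⟪ φ ∧ χ ⟫       W = ⟪ φ ⟫ W × ⟪ χ ⟫ W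
⟪ φ ∨ χ ⟫       W = ⟪ φ ⟫ W ⊎ ⟪ χ ⟫ W
⟪ φ ⇒ χ ⟫       W = ⟪ φ ⟫ W → ⟪ χ ⟫ W
⟪ ∃′ φ ⟫        W = ∃[ n ] ⟪ φ ⟫ ((_≡ n) ⊗ W)
⟪ ∀′ φ ⟫        W = ∀ n → ⟪ φ ⟫ ((_≡ n) ⊗ W)

module _ {v} (e : Vec ℤ v) (𝔐 : Interpretation) where

  meet-encode : ∀ t j → encode e 𝔐 j (lookup e t) ⇔ Meet (toℕ t) j (encode e 𝔐)
  meet-encode t j = mk⇔
    (λ x → _ , from (encode-lookup e 𝔐 t _) refl , x)
    (λ (n , eq , x) → subst (encode e 𝔐 j) (to (encode-lookup e 𝔐 t n) eq) x)

  before-encode : ∀ t t′ → (lookup e t < lookup e t′) ⇔ Before (toℕ t) (toℕ t′) (encode e 𝔐)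
  before-encode t t′ = mk⇔
    (λ lt → _ , _ , lt , from (encode-lookup e 𝔐 t _) refl , from (encode-lookup e 𝔐 t′ _) refl)
    (λ (n , n′ , lt , eq , eq′) → subst₂ _<_
       (to (encode-lookup e 𝔐 t n) eq) (to (encode-lookup e 𝔐 t′ n′) eq′) lt)

∃-⇔ : ∀ {a b c} {A : Set a} {B : A → Set b} {C : A → Set c} → (∀ x → B x ⇔ C x) → (∃[ x ] B x) ⇔ (∃[ x ] C x)
∃-⇔ B⇔C = mk⇔ (λ (x , y) → x , to (B⇔C x) y) (λ (x , y) → x , from (B⇔C x) y)

∀-⇔ : ∀ {a b c} {A : Set a} {B : A → Set b} {C : A → Set c} → (∀ x → B x ⇔ C x) → (∀ x → B x) ⇔ (∀ x → C x)
∀-⇔ B⇔C = mk⇔ (λ f x → to (B⇔C x) (f x)) (λ f x → from (B⇔C x) (f x))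

sat-encode : ∀ {v} 𝔐 (e : Vec ℤ v) φ → MFO-sat 𝔐 e φ ⇔ ⟪ φ ⟫ (encode e 𝔐)
sat-encode {v} 𝔐 e (a ▷ t) = meet-encode e 𝔐 t (v + a) ⇔-∘ ⇔-sym (encode-atomic e 𝔐 a _)
sat-encode 𝔐 e (t ≺ t′)    = before-encode e 𝔐 t t′
sat-encode 𝔐 e (t ≐ t′)    = meet-encode e 𝔐 t (toℕ t′) ⇔-∘ ⇔-sym (encode-lookup e 𝔐 t′ _)
sat-encode 𝔐 e (t ≐ t′ +1) =
  (before-encode e 𝔐 t′ t ×-⇔
   ¬-cong-⇔ (∃-⇔ λ n → before-encode (n ∷ e) 𝔐 (suc t′) zero ×-⇔ before-encode (n ∷ e) 𝔐 zero (suc t)))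
  ⇔-∘ mk⇔
    (λ eq → let t≡1+t′ = trans eq (i+1≡suc (lookup e t′)) in
       subst (_ <_) (sym t≡1+t′) (i<1+i (lookup e t′)) ,
       λ (n , lt , lt′) → ℤ.<⇒≱ (subst (n <_) t≡1+t′ lt′) (ℤ.i<j⇒suc[i]≤j lt))
    (λ (lt , ¬between) → trans (adjacent lt (λ between → ¬between (_ , i<1+i (lookup e t′) , between)))
                                (sym (i+1≡suc (lookup e t′))))
sat-encode 𝔐 e (∼ φ)       = ¬-cong-⇔ (sat-encode 𝔐 e φ)
sat-encode 𝔐 e (φ ∧ χ)     = sat-encode 𝔐 e φ ×-⇔ sat-encode 𝔐 e χ
sat-encode 𝔐 e (φ ∨ χ)     = sat-encode 𝔐 e φ ⊎-⇔ sat-encode 𝔐 e χ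
sat-encode 𝔐 e (φ ⇒ χ)     = →-cong-⇔ (sat-encode 𝔐 e φ) (sat-encode 𝔐 e χ)
sat-encode 𝔐 e (∃′ φ)      = ∃-⇔ λ n → sat-encode 𝔐 (n ∷ e) φ
sat-encode 𝔐 e (∀′ φ)      = ∀-⇔ λ n → sat-encode 𝔐 (n ∷ e) φ

-- Ontologies as first-order formulas

-- For `v` equal to 0 no variable is in scope, so the quantifier supplies one.
⊤ᶠ ⊥ᶠ : ∀ {v} → MFO v
⊤ᶠ = ∀′ (zero ≐ zero)
⊥ᶠ = ∼ ⊤ᶠ

⋀ ⋁ : ∀ {v} → List (MFO v) → MFO v
⋀ = foldr _∧_ ⊤ᶠ
⋁ = foldr _∨_ ⊥ᶠ

module _ {A : Set} {v} (𝔐 : Interpretation) (e : Vec ℤ v) {P : A → Set} {f : A → MFO v}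
         (f-sat : ∀ x → MFO-sat 𝔐 e (f x) ⇔ P x) where

  sat-⋀ : ∀ xs → MFO-sat 𝔐 e (⋀ (map f xs)) ⇔ All P xs
  sat-⋀ []       = mk⇔ (λ _ → []) (λ _ _ → refl)
  sat-⋀ (x ∷ xs) = mk⇔
    (λ (y , ys) → to (f-sat x) y ∷ to (sat-⋀ xs) ys)
    (λ { (y ∷ ys) → from (f-sat x) y , from (sat-⋀ xs) ys })

  sat-⋁ : ∀ xs → MFO-sat 𝔐 e (⋁ (map f xs)) ⇔ Any P xs
  sat-⋁ []       = mk⇔ (λ ¬⊤ → contradiction (λ _ → refl) ¬⊤) (λ ())
  sat-⋁ (x ∷ xs) = mk⇔
    (λ { (inj₁ y) → here (to (f-sat x) y) ; (inj₂ ys) → there (to (sat-⋁ xs) ys) })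
    (λ { (here y) → inj₁ (from (f-sat x) y) ; (there ys) → inj₂ (from (sat-⋁ xs) ys) })

conceptᶠ : ∀ {v} → Fin v → Concept → MFO v
conceptᶠ t (atom a) = a ▷ t
conceptᶠ t (□F C)   = ∀′ (suc t ≺ zero ⇒ conceptᶠ zero C)
conceptᶠ t (□P C)   = ∀′ (zero ≺ suc t ⇒ conceptᶠ zero C)
conceptᶠ t (○F C)   = ∃′ (zero ≐ suc t +1 ∧ conceptᶠ zero C)
conceptᶠ t (○P C)   = ∃′ (suc t ≐ zero +1 ∧ conceptᶠ zero C)

sat-conceptᶠ : ∀ {v} 𝔐 (e : Vec ℤ v) t C → MFO-sat 𝔐 e (conceptᶠ t C) ⇔ ⟦ C ⟧ 𝔐 (lookup e t)
sat-conceptᶠ 𝔐 e t (atom a) = ⇔-id _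
sat-conceptᶠ 𝔐 e t (□F C)   = ∀-⇔ λ k → →-cong-⇔ (⇔-id _) (sat-conceptᶠ 𝔐 (k ∷ e) zero C)
sat-conceptᶠ 𝔐 e t (□P C)   = ∀-⇔ λ k → →-cong-⇔ (⇔-id _) (sat-conceptᶠ 𝔐 (k ∷ e) zero C)
sat-conceptᶠ 𝔐 e t (○F C)   = mk⇔
  (λ { (k , refl , x) → to (sat-conceptᶠ 𝔐 (k ∷ e) zero C) x })
  (λ x → _ , refl , from (sat-conceptᶠ 𝔐 (_ ∷ e) zero C) x)
sat-conceptᶠ 𝔐 e t (○P C)   = mk⇔
  (λ (k , eq , x) → subst (⟦ C ⟧ 𝔐)
     (sym (trans (cong (_-ℤ 1ℤ) (trans eq (i+1≡suc k))) (trans (ℤ.+-comm (sucℤ k) -1ℤ) (ℤ.pred-suc k))))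
     (to (sat-conceptᶠ 𝔐 (k ∷ e) zero C) x))
  (λ x → _ , sym (trans (i+1≡suc (lookup e t -ℤ 1ℤ)) (trans (cong sucℤ (ℤ.+-comm (lookup e t) -1ℤ)) (ℤ.suc-pred _))) ,
     from (sat-conceptᶠ 𝔐 (_ ∷ e) zero C) x)

clauseᶠ : ∀ {v} → Clause → MFO v
clauseᶠ (body ⟶ head) = ∀′ (⋀ (map (conceptᶠ zero) body) ⇒ ⋁ (map (conceptᶠ zero) head))

sat-clauseᶠ : ∀ {v} 𝔐 (e : Vec ℤ v) γ → MFO-sat 𝔐 e (clauseᶠ γ) ⇔ TrueIn 𝔐 γ
sat-clauseᶠ 𝔐 e (body ⟶ head) = mk⇔
  (λ f {n} → to (clause-at n) (f n))
  (λ f n → from (clause-at n) f)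
  where
  clause-at : ∀ n → _ ⇔ _
  clause-at n = →-cong-⇔ (sat-⋀ 𝔐 (n ∷ e) (sat-conceptᶠ 𝔐 (n ∷ e) zero) body)
                         (sat-⋁ 𝔐 (n ∷ e) (sat-conceptᶠ 𝔐 (n ∷ e) zero) head)

-- The facts are left out, so that the formula depends on the query alone; they enter through the
-- word.
refutation : ∀ {m} → OMQ m → MFO m
refutation ⟨ 𝒪 , ψ ⟩ = ⋀ (map clauseᶠ 𝒪) ∧ ∼ ψ

sat-refutation : ∀ {m} 𝔐 (e : Vec ℤ m) 𝒪 ψ →
  MFO-sat 𝔐 e (refutation ⟨ 𝒪 , ψ ⟩) ⇔ (All (TrueIn 𝔐) 𝒪 × ¬ MFO-sat 𝔐 e ψ)
sat-refutation 𝔐 e 𝒪 ψ = sat-⋀ 𝔐 e (sat-clauseᶠ 𝔐 e) 𝒪 ×-⇔ ⇔-id _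

-- Certain answers as absence of a refuting word

-- A countermodel may add to the data, but the variables keep their values.
Enlarges : ℕ → (ℕ → Set) → (ℕ → Set) → Set
Enlarges m x w = ∀ i → (x i → w i) × (i <ℕ m → w i → x i)

Refutable : ∀ {m} → OMQ m → Interpretation → Set₁
Refutable {m} q X =
  ∃[ W ] ((∀ n → Enlarges m (λ i → X i n) (λ i → W i n)) × ⟪ refutation q ⟫ W)

factsᴵ : DataInstance → Interpretation
factsᴵ 𝒜 a n = (a , n) ∈ˡ facts 𝒜

dataWord : ∀ {m} (𝒜 : DataInstance) → Vec (tem 𝒜) m → Interpretation
dataWord 𝒜 ℓs = encode (mapᵛ proj₁ ℓs) (factsᴵ 𝒜)

module Query (em : ExcludedMiddle (lsuc 0ℓ)) where
  open Classical em

  regular-⟪⟫ : ∀ {v} (φ : MFO v) → Regular ⟪ φ ⟫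
  regular-⟪⟫ (a ▷ t)     = regular-meet _ _
  regular-⟪⟫ (t ≺ t′)    = regular-before _ _
  regular-⟪⟫ (t ≐ t′)    = regular-meet _ _
  regular-⟪⟫ (t ≐ t′ +1) = regular-× (regular-before _ _)
    (regular-¬ (regular-∃₁ (regular-× (regular-before (toℕ (suc t′)) 0) (regular-before 0 (toℕ (suc t))))))
  regular-⟪⟫ (∼ φ)       = regular-¬ (regular-⟪⟫ φ)
  regular-⟪⟫ (φ ∧ χ)     = regular-× (regular-⟪⟫ φ) (regular-⟪⟫ χ)
  regular-⟪⟫ (φ ∨ χ)     = regular-⊎ (regular-⟪⟫ φ) (regular-⟪⟫ χ)
  regular-⟪⟫ (φ ⇒ χ)     = regular-→ (regular-⟪⟫ φ) (regular-⟪⟫ χ)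
  regular-⟪⟫ (∃′ φ)      = regular-∃₁ (regular-⟪⟫ φ)
  regular-⟪⟫ (∀′ φ)      = regular-∀₁ (regular-⟪⟫ φ)

  regular-refutable : ∀ {m} (q : OMQ m) → Regular (Refutable q)
  regular-refutable {m} q = regular-∃ (Enlarges m)
    (λ x x′ w x≈ enl i → proj₁ (enl i) ∘ from (x≈ i) , λ i<m → to (x≈ i) ∘ proj₂ (enl i) i<m)
    (regular-⟪⟫ (refutation q)) lifting
    where
    B : ℕ
    B = width (regular-⟪⟫ (refutation q))
    module _ (x x′ w : ℕ → Set) (x≈ : ∀ i → i <ℕ B → x i ⇔ x′ i) (enl : Enlarges m x w) where
      w′ : ℕ → Set
      -- Below `B` the column must stay as `w`; from `B` on, where `x` and `x′` may differ, `x′`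
      -- trivially enlarges itself.
      w′ i with i ℕ.<? B
      ... | yes _ = w i
      ... | no  _ = x′ i
      enl′ : Enlarges m x′ w′
      enl′ i with i ℕ.<? B
      ... | yes i< = proj₁ (enl i) ∘ from (x≈ i i<) , λ i<m → to (x≈ i i<) ∘ proj₂ (enl i) i<m
      ... | no  _  = (λ y → y) , λ _ y → y
      w≈w′ : ∀ i → i <ℕ B → w i ⇔ w′ i
      w≈w′ i i< with i ℕ.<? B
      ... | yes _  = ⇔-id _
      ... | no ¬i< = contradiction i< ¬i<
      lifting : ∃[ w″ ] (Enlarges m x′ w″ × (∀ i → i <ℕ B → w i ⇔ w″ i))
      lifting = w′ , enl′ , w≈w′

  -- A countermodel is encoded together with the answer tuple; conversely, a refuting word is
  -- decoded, its variable tracks being forced by `Enlarges`. Excluded middle passes from the lack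
  -- of a countermodel to the truth of `ψ`.
  certain-⇔ : ∀ {m} (q : OMQ m) 𝒜 (ℓs : Vec (tem 𝒜) m) →
              CertainAnswer q 𝒜 ℓs ⇔ (¬ Refutable q (dataWord 𝒜 ℓs))
  certain-⇔ {m} q@(⟨ 𝒪 , ψ ⟩) 𝒜 ℓs = mk⇔ sound complete
    where
    e = mapᵛ proj₁ ℓs
    D = factsᴵ 𝒜
    sound : CertainAnswer q 𝒜 ℓs → ¬ Refutable q (dataWord 𝒜 ℓs)
    sound certain (W , enl , ref) = ¬ψ (certain 𝔐 (𝒪-true , All.tabulate (λ {(a , n)} f →
        proj₁ (enl n (m + a)) (from (encode-atomic e D a n) f))))
      where
      𝔐 : Interpretation
      𝔐 a = W (m + a)
      W≈ : W ≈ encode e 𝔐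
      W≈ = encode-decode e D W (λ i i<m n → mk⇔ (proj₂ (enl n i) i<m) (proj₁ (enl n i)))
      refuted = to (sat-refutation 𝔐 e 𝒪 ψ)
        (from (sat-encode 𝔐 e (refutation q)) (respects (regular-⟪⟫ (refutation q)) _ _ W≈ ref))
      𝒪-true = proj₁ refuted
      ¬ψ = proj₂ refuted
    complete : ¬ Refutable q (dataWord 𝒜 ℓs) → CertainAnswer q 𝒜 ℓs
    complete irrefutable 𝔐 (𝒪-true , D-true) = decidable-stable em₀ λ ¬ψ → irrefutable
      ( encode e 𝔐
      , (λ n i → encode-mono e (λ a n → All.lookup D-true) i n , λ i<m → encode-variable e 𝔐 D i n i<m)
      , to (sat-encode 𝔐 e (refutation q)) (from (sat-refutation 𝔐 e 𝒪 ψ) (𝒪-true , ¬ψ)))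

-- Boolean functions as formulas of either target logic

reflects-cong : {A : Set ℓ} {B : Set ℓ′} → A ⇔ B → ∀ {b} → Reflects A b → Reflects B b
reflects-cong A⇔B (ofʸ x)  = ofʸ (to A⇔B x)
reflects-cong A⇔B (ofⁿ ¬x) = ofⁿ (¬x ∘ from A⇔B)

reflects-det : {A : Set ℓ} {B : Set ℓ′} → ∀ {b} → Reflects A b → Reflects B b → A ⇔ B
reflects-det (ofʸ x)  (ofʸ y)  = mk⇔ (λ _ → y) (λ _ → x)
reflects-det (ofⁿ ¬x) (ofⁿ ¬y) = mk⇔ (λ x → contradiction x ¬x) (λ y → contradiction y ¬y)

record Connectives (F : Set) : Set where
  field
    tt        : F
    neg       : F → F
    conj disj : F → F → F

record Interprets {F : Set} (C : Connectives F) (sat : F → Set ℓ) : Set ℓ where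
  open Connectives C
  field
    sat-tt   : sat tt
    sat-neg  : ∀ φ → sat (neg φ) ⇔ (¬ sat φ)
    sat-conj : ∀ φ χ → sat (conj φ χ) ⇔ (sat φ × sat χ)
    sat-disj : ∀ φ χ → sat (disj φ χ) ⇔ (sat φ ⊎ sat χ)

-- Shannon expansion: every Boolean function of finitely many formulas is
-- a formula.
module Shannon {F : Set} (C : Connectives F) where
  open Connectives C

  choose : ∀ {k} → Vec F k → (Vec Bool k → F) → F
  choose []       G = G []
  choose (φ ∷ φs) G = disj (conj φ (choose φs (G ∘ (true ∷_))))
                           (conj (neg φ) (choose φs (G ∘ (false ∷_))))

  constant : Bool → F
  constant true  = tt
  constant false = neg tt

  -- Describes track `i` of an encoded word at the current point: first the tracks of the variables,
  -- then those of the concepts.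
  letter : ∀ {v m} → (Atomic → F) → (Fin v → F) → Vec (Fin v) m → ℕ → F
  letter atomᶠ eqᶠ []       a       = atomᶠ a
  letter atomᶠ eqᶠ (z ∷ zs) zero    = eqᶠ z
  letter atomᶠ eqᶠ (z ∷ zs) (suc i) = letter atomᶠ eqᶠ zs i

  module Semantics {sat : F → Set ℓ} (I : Interprets C sat) where
    open Interprets I

    sat-choose : ∀ {k} {φs : Vec F k} {bs} → Pointwise (λ φ b → Reflects (sat φ) b) φs bs →
                 ∀ G → sat (choose φs G) ⇔ sat (G bs)
    sat-choose []             G = ⇔-id _
    sat-choose (ofʸ x ∷ rs)   G = mk⇔
      (λ y → [ to (sat-choose rs _) ∘ proj₂ ∘ to (sat-conj _ _)
             , (λ z → contradiction x (to (sat-neg _) (proj₁ (to (sat-conj _ _) z)))) ] (to (sat-disj _ _) y))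
      (λ y → from (sat-disj _ _) (inj₁ (from (sat-conj _ _) (x , from (sat-choose rs _) y))))
    sat-choose (ofⁿ ¬x ∷ rs) G = mk⇔
      (λ y → [ (λ z → contradiction (proj₁ (to (sat-conj _ _) z)) ¬x)
             , to (sat-choose rs _) ∘ proj₂ ∘ to (sat-conj _ _) ] (to (sat-disj _ _) y))
      (λ y → from (sat-disj _ _) (inj₂ (from (sat-conj _ _) (from (sat-neg _) ¬x , from (sat-choose rs _) y))))

    sat-constant : {A : Set ℓ′} → ∀ {b} → Reflects A b → sat (constant b) ⇔ A
    sat-constant (ofʸ x)  = mk⇔ (λ _ → x) (λ _ → sat-tt)
    sat-constant (ofⁿ ¬x) = mk⇔ (λ y → contradiction sat-tt (to (sat-neg _) y)) (λ x → contradiction x ¬x)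

    sat-letter : ∀ {v m} (atomᶠ : Atomic → F) (eqᶠ : Fin v → F) (D : Interpretation) (val : Fin v → ℤ) (n : ℤ) →
                 (∀ a → sat (atomᶠ a) ⇔ D a n) → (∀ z → sat (eqᶠ z) ⇔ n ≡ val z) →
                 ∀ (zs : Vec (Fin v) m) i → sat (letter atomᶠ eqᶠ zs i) ⇔ encode (mapᵛ val zs) D i n
    sat-letter atomᶠ eqᶠ D val n sat-atom sat-eq []       a       = sat-atom a
    sat-letter atomᶠ eqᶠ D val n sat-atom sat-eq (z ∷ zs) zero    = sat-eq z
    sat-letter atomᶠ eqᶠ D val n sat-atom sat-eq (z ∷ zs) (suc i) = sat-letter atomᶠ eqᶠ D val n sat-atom sat-eq zs i

-- The sequence of classes along a data instance

-- The class of `shiftBy k X` is that of the prefix of `X` ending at `k - 1`.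
shiftBy : ℕ → Interpretation → Interpretation
shiftBy k X i n = X i (n +ℤ + k)

shiftBy-zero : ∀ X → shiftBy 0 X ≈ X
shiftBy-zero X i n = ≡⇒⇔ (cong (X i) (ℤ.+-identityʳ n))

shift-shiftBy : ∀ k X → shift (shiftBy k X) ≈ shiftBy (suc k) X
shift-shiftBy k X i n = ≡⇒⇔ (cong (X i)
  (trans (cong (_+ℤ + k) (ℤ.+-comm 1ℤ n)) (ℤ.+-assoc n 1ℤ (+ k))))

firstTrue : ∀ {n} {A : Set} → A → (Fin n → A) → Vec Bool n → A
firstTrue d f []           = d
firstTrue d f (true ∷ _)   = f zero
firstTrue d f (false ∷ bs) = firstTrue d (f ∘ suc) bs

firstTrue-none : ∀ {n} {A : Set} d (f : Fin n → A) → firstTrue d f (tabulate (λ _ → false)) ≡ d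
firstTrue-none {zero}  d f = refl
firstTrue-none {suc n} d f = firstTrue-none d (f ∘ suc)

firstTrue-single : ∀ {n} {A : Set} d (f : Fin n → A) s → firstTrue d f (tabulate (λ s′ → does (s ≟ s′))) ≡ f s
firstTrue-single d f zero    = refl
firstTrue-single d f (suc s) = firstTrue-single d (f ∘ suc) s

dataWord-bounded : ∀ {m} 𝒜 (ℓs : Vec (tem 𝒜) m) i n → dataWord 𝒜 ℓs i n → 0ℤ ≤ n × n ≤ max 𝒜
dataWord-bounded 𝒜 []           i       n f    =
  All.lookup (min-least 𝒜) (∈-map⁺ proj₂ f) , All.lookup (max-most 𝒜) (∈-map⁺ proj₂ f)
dataWord-bounded 𝒜 ((_ , b) ∷ _) zero   n refl = b
dataWord-bounded 𝒜 (_ ∷ ℓs)     (suc i) n x    = dataWord-bounded 𝒜 ℓs i n x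

1≤⇒+ : ∀ {z} → 1ℤ ≤ z → ∃[ k ] z ≡ + k
1≤⇒+ {+ k} _ = k , refl

module Automaton (em : ExcludedMiddle (lsuc 0ℓ)) {P : Interpretation → Set₁} (p : Regular P) where
  open Classical em

  initial : Fin (size p)
  initial = state p (λ _ _ → ⊥)

  -- A vector of Booleans stands for the state at which it is true; no
  -- state is marked before the first step.
  marked : Vec Bool (size p) → Fin (size p)
  marked = firstTrue initial (λ s → s)

  -- The transition goes through a representative `Y` of the marked class; by `step` the resulting
  -- class does not depend on the choice of `Y`. Acceptance below is likewise independent by
  -- `future`.
  Follows : Vec Bool (width p) → Vec Bool (size p) → Fin (size p) → Set₁
  Follows c b s = ∃[ Y ] (state p Y ≡ marked b × (∀ i → Reflects (Y (toℕ i) 0ℤ) (lookup c i)) ×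
                          state p (shift Y) ≡ s)

  Accepts : Vec Bool (size p) → Set₁
  Accepts b = ∃[ Y ] (state p Y ≡ marked b × (∀ i k → ¬ Y i (+ k)) × P Y)

  module Run (X : Interpretation) (X-past : ∀ i k → ¬ X i -[1+ k ])
             (M : ℕ) (X-future : ∀ i k → ¬ X i (+ (k + suc M))) where

    -- `Run (suc k)` is the row of relations at time `k`. `Run 0` is empty, just as recursively
    -- defined relations are false at time -1.
    Run : ℕ → Fin (size p) → Set
    Run zero    s = ⊥
    Run (suc k) s = state p (shiftBy (suc k) X) ≡ s

    marks : ℕ → Vec Bool (size p)
    marks zero    = tabulate (λ _ → false)
    marks (suc k) = tabulate (λ s → does (state p (shiftBy (suc k) X) ≟ s))

    marks-reflect : {F : Set} {sat : F → Set ℓ} (φ : Fin (size p) → F) → ∀ k →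
                    (∀ s → sat (φ s) ⇔ Run k s) →
                    Pointwise (λ φ b → Reflects (sat φ) b) (tabulate φ) (marks k)
    marks-reflect φ zero    φ⇔ = tabulate⁺ (λ s → ofⁿ (to (φ⇔ s)))
    marks-reflect φ (suc k) φ⇔ = tabulate⁺ (λ s → reflects-cong (⇔-sym (φ⇔ s)) (proof (_ ≟ s)))

    -- At 0 the default class is right because `X` is empty before 0.
    marked-marks : ∀ k → marked (marks k) ≡ state p (shiftBy k X)
    marked-marks zero    = trans (firstTrue-none initial (λ s → s)) (past p _ _ λ i k →
      mk⇔ ⊥-elim (X-past i k ∘ to (shiftBy-zero X i -[1+ k ])))
    marked-marks (suc k) = firstTrue-single initial (λ s → s) _

    column : ℕ → Vec Bool (width p)
    column k = tabulate (λ i → does (em₀ {X (toℕ i) (+ k)}))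

    follows-⇔ : ∀ k s → Follows (column k) (marks k) s ⇔ Run (suc k) s
    follows-⇔ k s = mk⇔
      (λ (Y , eq , Y-column , eq′) → trans (sym next≡)
         (trans (step p _ Y (trans (sym (marked-marks k)) (sym eq)) (λ i i< →
           subst (λ j → X j (+ k) ⇔ Y j 0ℤ) (toℕ-fromℕ< i<)
             (reflects-det (X-column (fromℕ< i<)) (Y-column (fromℕ< i<))))) eq′))
      (λ eq → shiftBy k X , sym (marked-marks k) , X-column , trans next≡ eq)
      where
      X-column : ∀ i → Reflects (X (toℕ i) (+ k)) (lookup (column k) i)
      X-column i = subst (Reflects _) (sym (lookup∘tabulate _ i)) (proof em₀)
      next≡ : state p (shift (shiftBy k X)) ≡ state p (shiftBy (suc k) X)
      next≡ = past p _ _ (λ i n → shift-shiftBy k X i -[1+ n ])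

    P-shiftBy : ∀ k → P X ⇔ P (shiftBy k X)
    P-shiftBy zero    = mk⇔ (respects p _ _ (λ i n → ⇔-sym (shiftBy-zero X i n)))
                            (respects p _ _ (shiftBy-zero X))
    P-shiftBy (suc k) = mk⇔ (respects p _ _ (shift-shiftBy k X))
                            (respects p _ _ (λ i n → ⇔-sym (shift-shiftBy k X i n)))
                        ⇔-∘ (invariant p _ ⇔-∘ P-shiftBy k)

    -- After `suc M` shifts nothing is left from 0 on, so the class alone decides `P`.
    accepts-⇔ : Accepts (marks (suc M)) ⇔ P X
    accepts-⇔ = mk⇔
      (λ (Y , eq , Y-empty , PY) → from (P-shiftBy (suc M))
         (future p Y _ (trans eq (marked-marks (suc M)))
           (λ i k → mk⇔ (λ y → contradiction y (Y-empty i k)) (λ x → contradiction x (X-future i k))) PY))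
      (λ PX → shiftBy (suc M) X , sym (marked-marks (suc M)) , X-future , to (P-shiftBy (suc M)) PX)

  -- Formulas for transition and rejection

  module Formulas {F : Set} (C : Connectives F) where
    open Shannon C

    -- Whether a letter and a row lead to `s` does not depend on the data, so excluded middle
    -- settles it outside the formula and only a constant remains.
    follows : Fin (size p) → Vec Bool (width p) → Vec Bool (size p) → F
    follows s c b = constant (does (em {Follows c b s}))

    transition : (ℕ → F) → (Fin (size p) → F) → Fin (size p) → F
    transition χ φ s = choose (tabulate (χ ∘ toℕ)) λ c → choose (tabulate φ) (follows s c)

    rejects : Vec Bool (size p) → F
    rejects b = constant (does (¬? (em {Accepts b})))

    rejection : (Fin (size p) → F) → F
    rejection φ = choose (tabulate φ) rejects

    module Correctness {sat : F → Set ℓ} (I : Interprets C sat)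
                       (X : Interpretation) (X-past : ∀ i k → ¬ X i -[1+ k ])
                       (M : ℕ) (X-future : ∀ i k → ¬ X i (+ (k + suc M))) where
      open Semantics I
      open Run X X-past M X-future

      sat-transition : ∀ k χ φ → (∀ i → sat (χ i) ⇔ X i (+ k)) → (∀ s → sat (φ s) ⇔ Run k s) →
                       ∀ s → sat (transition χ φ s) ⇔ Run (suc k) s
      sat-transition k χ φ χ⇔ φ⇔ s =
        follows-⇔ k s ⇔-∘ (sat-constant (proof em) ⇔-∘
          (sat-choose (marks-reflect φ k φ⇔) (follows s (column k)) ⇔-∘
           sat-choose (tabulate⁺ (λ i → reflects-cong (⇔-sym (χ⇔ (toℕ i))) (proof em₀)))
                      (λ c → choose (tabulate φ) (follows s c))))

      sat-rejection : ∀ φ → (∀ s → sat (φ s) ⇔ Run (suc M) s) → sat (rejection φ) ⇔ (¬ P X)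
      sat-rejection φ φ⇔ = ¬-cong-⇔ accepts-⇔ ⇔-∘ (sat-constant (proof (¬? em)) ⇔-∘
        sat-choose (marks-reflect φ (suc M) φ⇔) rejects)

-- Ingredients shared by the two rewritings

-- Index 0 is reserved for time, so the answer variables start at 1.
variables : ∀ m → Vec (Fin (suc m)) m
variables m = mapᵛ suc (allFin m)

map-variables : ∀ {A : Set} {m} (x : A) (xs : Vec A m) → mapᵛ (lookup (x ∷ xs)) (variables m) ≡ xs
map-variables x xs = trans (sym (map-∘ (lookup (x ∷ xs)) suc (allFin _))) (map-lookup-allFin xs)

map-proj-variables : ∀ {A : Set} {B : A → Set} {m} (x : Σ[ y ∈ A ] B y) xs →
  mapᵛ (λ z → proj₁ (lookup (x ∷ xs) z)) (variables m) ≡ mapᵛ proj₁ xs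
map-proj-variables x xs =
  trans (map-∘ proj₁ (lookup (x ∷ xs)) (variables _)) (cong (mapᵛ proj₁) (map-variables x xs))

connectivesᴿ : ∀ {r} {Γ : Vector ℕ r} {v} → Connectives (FORPR Γ (suc v))
connectivesᴿ = record { tt = zero ≐ zero ; neg = ∼_ ; conj = _∧_ ; disj = _∨_ }

interpretsᴿ : ∀ {r} {Γ : Vector ℕ r} {v} 𝒜 R e → Interprets (connectivesᴿ {Γ = Γ} {v}) (FORPR-sat 𝒜 R e)
interpretsᴿ 𝒜 R e = record
  { sat-tt = refl ; sat-neg = λ _ → ⇔-id _ ; sat-conj = λ _ _ → ⇔-id _ ; sat-disj = λ _ _ → ⇔-id _ }

connectivesᴹ : ∀ {s v} → Connectives (MSO s (suc v))
connectivesᴹ = record { tt = ∼ (zero ≺ zero) ; neg = ∼_ ; conj = _∧_ ; disj = _∨_ }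

interpretsᴹ : ∀ {s v} 𝒜 E e → Interprets (connectivesᴹ {s} {v}) (MSO-sat 𝒜 E e)
interpretsᴹ 𝒜 E e = record
  { sat-tt   = λ (lift lt) → ℤ.<-irrefl refl lt
  ; sat-neg  = λ _ → ⇔-id _
  ; sat-conj = λ _ _ → ⇔-id _
  ; sat-disj = λ _ _ → ⇔-id _
  }

module Rewriting (em : ExcludedMiddle (lsuc 0ℓ)) {m} (q : OMQ m) where
  open Classical em
  open Query em

  p : Regular (Refutable q)
  p = regular-refutable q

  open Automaton em p

  N : ℕ
  N = size p

  module Instance (𝒜 : DataInstance) (ℓs : Vec (tem 𝒜) m) where

    X : Interpretation
    X = dataWord 𝒜 ℓs

    M : ℕ
    M = proj₁ (1≤⇒+ (1≤max 𝒜))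

    max≡ : max 𝒜 ≡ + M
    max≡ = proj₂ (1≤⇒+ (1≤max 𝒜))

    X-past : ∀ i k → ¬ X i -[1+ k ]
    X-past i k x with () ← proj₁ (dataWord-bounded 𝒜 ℓs i _ x)

    X-future : ∀ i k → ¬ X i (+ (k + suc M))
    X-future i k x = ℕ.n≮n M (ℕ.≤-trans (ℕ.m≤n+m (suc M) k)
      (ℤ.drop‿+≤+ (subst (+ (k + suc M) ≤_) max≡ (proj₂ (dataWord-bounded 𝒜 ℓs i _ x)))))

    open Run X X-past M X-future public

    column-⇔ : ∀ (t : tem 𝒜) i →
      encode (mapᵛ (λ z → proj₁ (lookup (t ∷ ℓs) z)) (variables m)) (factsᴵ 𝒜) i (proj₁ t) ⇔ X i (proj₁ t)
    column-⇔ t i = ≡⇒⇔ (cong (λ e → encode e (factsᴵ 𝒜) i (proj₁ t)) (map-proj-variables t ℓs))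

    last : tem 𝒜
    last = max 𝒜 , subst (0ℤ ≤_) (sym max≡) (+≤+ z≤n) , ℤ.≤-refl

  -- The rewriting by relational recursion

  -- One relation per class; its parameters are the answer tuple.
  Δ : Vector ℕ N
  Δ _ = m

  module Θᴿ = Formulas (connectivesᴿ {Γ = Δ} {m})

  letterᴿ : ℕ → FORPR Δ (suc m)
  letterᴿ = Shannon.letter connectivesᴿ (_▷ zero) (zero ≐_) (variables m)

  previousᴿ : Fin N → FORPR Δ (suc m)
  previousᴿ s = rel s (variables m)

  Θ : (s : Fin N) → FORPR Δ (suc m)
  Θ = Θᴿ.transition letterᴿ previousᴿ

  module _ {k} {Γ : Vector ℕ k} {Γ′ : Vector ℕ 0} where
    arity : ∀ j → Γ j ≡ (Γ ++ Γ′) (j ↑ˡ 0)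
    arity j = sym (cong [ Γ , Γ′ ] (splitAt-↑ˡ k j 0))

    relˡ : ∀ {v} j → Vec (Fin v) (Γ j) → FORPR (Γ ++ Γ′) v
    relˡ j us = rel (j ↑ˡ 0) (subst (Vec _) (arity j) us)

    sat-relˡ : ∀ {v} 𝒜 (R : Relations (tem 𝒜) Γ) (R′ : Relations (tem 𝒜) Γ′) (e : Vec (tem 𝒜) v) j us →
      FORPR-sat 𝒜 (R ++ᴿ R′) e (relˡ j us) ⇔ R j (mapᵛ (lookup e) us)
    sat-relˡ 𝒜 R R′ e j us with splitAt k (j ↑ˡ 0) | splitAt-↑ˡ k j 0
    ... | .(inj₁ j) | refl = ⇔-id _

  Γ : Vector ℕ (N + 0)
  Γ = (suc ∘ Δ) ++ []ᶠ

  module Ψᴿ = Formulas (connectivesᴿ {Γ = Γ} {m})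

  currentᴿ : Fin N → FORPR Γ (suc m)
  currentᴿ s = relˡ s (zero ∷ variables m)

  rewritingᴿ : FORPR []ᶠ m
  -- The point without a successor is the last timestamp, where the row gives the class of the whole
  -- data word.
  rewritingᴿ = rec Δ Θ (∃′ (∼ (∃′ (zero ≐ suc zero +1)) ∧ Ψᴿ.rejection currentᴿ))

  module _ (𝒜 : DataInstance) (ℓs : Vec (tem 𝒜) m) where
    open Instance 𝒜 ℓs

    nextᴿ : Relations (tem 𝒜) Δ → Relations (tem 𝒜) (suc ∘ Δ)
    nextᴿ R i e = FORPR-sat 𝒜 R e (Θ i)

    sat-Θ : ∀ k (b : 0ℤ ≤ + k × + k ≤ max 𝒜) (R : Relations (tem 𝒜) Δ) → (∀ s → R s ℓs ⇔ Run k s) →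
            ∀ s → FORPR-sat 𝒜 R ((+ k , b) ∷ ℓs) (Θ s) ⇔ Run (suc k) s
    sat-Θ k b R R⇔ = Θᴿ.Correctness.sat-transition (interpretsᴿ 𝒜 R e) X X-past M X-future
      k letterᴿ previousᴿ
      (λ i → column-⇔ (+ k , b) i ⇔-∘
        Shannon.Semantics.sat-letter connectivesᴿ (interpretsᴿ 𝒜 R e) (_▷ zero) (zero ≐_)
          (factsᴵ 𝒜) (λ z → proj₁ (lookup e z)) (+ k)
          (λ a → ⇔-id _) (λ z → ⇔-id _) (variables m) i)
      (λ s → R⇔ s ⇔-∘ ≡⇒⇔ (cong (R s) (map-variables (+ k , b) ℓs)))
      where
      e : Vec (tem 𝒜) (suc m)
      e = (+ k , b) ∷ ℓs

    stage-⇔ : ∀ k k≤max s → stage 𝒜 Δ nextᴿ k k≤max s ℓs ⇔ Run (suc k) s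
    stage-⇔ zero    k≤max = sat-Θ 0 _ _ (λ s → ⇔-id _)
    stage-⇔ (suc k) k≤max = sat-Θ (suc k) _ _ (stage-⇔ k _)

    private
      R : Relations (tem 𝒜) Γ
      R = recursion 𝒜 Δ nextᴿ ++ᴿ (λ ())

    recursion-⇔ : ∀ t → proj₁ t ≡ + M → ∀ s → recursion 𝒜 Δ nextᴿ s (t ∷ ℓs) ⇔ Run (suc M) s
    recursion-⇔ (.(+ M) , _ , b) refl s = stage-⇔ M b s

    sat-Ψ : ∀ t → proj₁ t ≡ + M →
            FORPR-sat 𝒜 R (t ∷ ℓs) (Ψᴿ.rejection currentᴿ) ⇔ (¬ Refutable q X)
    sat-Ψ t t≡M = Ψᴿ.Correctness.sat-rejection (interpretsᴿ 𝒜 R (t ∷ ℓs)) X X-past M X-future currentᴿ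
      (λ s → recursion-⇔ t t≡M s ⇔-∘
        (≡⇒⇔ (cong (λ u → recursion 𝒜 Δ nextᴿ s (t ∷ u)) (map-variables t ℓs)) ⇔-∘
         sat-relˡ 𝒜 (recursion 𝒜 Δ nextᴿ) (λ ()) (t ∷ ℓs) s (zero ∷ variables m)))

    is-last : (t : tem 𝒜) → ¬ (∃[ u ] (proj₁ {B = λ n → 0ℤ ≤ n × n ≤ max 𝒜} u ≡ proj₁ t +ℤ 1ℤ)) → proj₁ t ≡ + M
    is-last (t , 0≤t , t≤max) ¬next = trans (ℤ.≤-antisym t≤max (ℤ.≮⇒≥ λ t<max → ¬next
      ((sucℤ t , ℤ.≤-trans 0≤t (ℤ.i≤suc[i] t) , ℤ.i<j⇒suc[i]≤j t<max) ,
       sym (i+1≡suc t)))) max≡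

    rewritingᴿ-correct : CertainAnswer q 𝒜 ℓs ⇔ FORPR-sat 𝒜 (λ ()) ℓs rewritingᴿ
    rewritingᴿ-correct = mk⇔
      (λ irr → last ,
        (λ ((u , _ , u≤max) , u≡) → ℤ.<⇒≱ (i<1+i (max 𝒜))
           (subst (_≤ max 𝒜) (trans u≡ (i+1≡suc (max 𝒜))) u≤max)) ,
        from (sat-Ψ last max≡) irr)
      (λ (t , ¬next , rej) → to (sat-Ψ t (is-last t ¬next)) rej)
      ⇔-∘ certain-⇔ q 𝒜 ℓs

  -- The rewriting by monadic second-order quantifiers

  module Θᴹ = Formulas (connectivesᴹ {N} {m})

  eqᴹ : ∀ {s v} → Fin v → Fin v → MSO s v
  eqᴹ t t′ = ∼ (t ≺ t′) ∧ ∼ (t′ ≺ t)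

  -- Membership of the immediate predecessor. The first timestamp has none, so the formula fails
  -- there, as `Run 0` does.
  previousᴹ : Fin N → MSO N (suc m)
  previousᴹ s = ∃′ (zero ≺ suc zero ∧ ∼ (∃′ (suc zero ≺ zero ∧ zero ≺ suc (suc zero))) ∧ s ∋ zero)

  letterᴹ : ℕ → MSO N (suc m)
  letterᴹ = Shannon.letter connectivesᴹ (_▷ zero) (eqᴹ zero) (variables m)

  nextᴹ : Fin N → MSO N (suc m)
  nextᴹ = Θᴹ.transition letterᴹ previousᴹ

  allᴹ : ∀ {n s v} → (Fin n → MSO s (suc v)) → MSO s (suc v)
  allᴹ {zero}  φ = ∼ (zero ≺ zero)
  allᴹ {suc n} φ = φ zero ∧ allᴹ (φ ∘ suc)

  close : ∀ {v} s → MSO s v → MSO 0 v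
  close zero    φ = φ
  close (suc s) φ = close s (∃² φ)

  sat-close : ∀ {v} 𝒜 (e : Vec (tem 𝒜) v) s φ → MSO-sat 𝒜 [] e (close s φ) ⇔ (∃[ E ] MSO-sat 𝒜 E e φ)
  sat-close 𝒜 e zero    φ = mk⇔ (λ x → [] , x) (λ { ([] , x) → x })
  sat-close 𝒜 e (suc s) φ =
    mk⇔ (λ (E , Y , x) → (Y ∷ E) , x) (λ { ((Y ∷ E) , x) → E , Y , x }) ⇔-∘ sat-close 𝒜 e s (∃² φ)

  sat-allᴹ : ∀ {n s v} 𝒜 E (e : Vec (tem 𝒜) (suc v)) (φ : Fin n → MSO s (suc v)) →
             MSO-sat 𝒜 E e (allᴹ φ) ⇔ (∀ i → MSO-sat 𝒜 E e (φ i))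
  sat-allᴹ {zero}  𝒜 E e φ = mk⇔ (λ _ ()) (λ _ (lift lt) → ℤ.<-irrefl refl lt)
  sat-allᴹ {suc n} 𝒜 E e φ = mk⇔
    (λ { (x , xs) zero → x ; (x , xs) (suc i) → to (sat-allᴹ 𝒜 E e (φ ∘ suc)) xs i })
    (λ f → f zero , from (sat-allᴹ 𝒜 E e (φ ∘ suc)) (f ∘ suc))

  -- Required at every timestamp, these equivalences are the recursion equations; by induction on
  -- time they leave the run as the only solution.
  definingᴹ : Fin N → MSO N (suc m)
  definingᴹ s = (s ∋ zero ⇒ nextᴹ s) ∧ (nextᴹ s ⇒ s ∋ zero)

  matrixᴹ : MSO N m
  matrixᴹ = (∀′ allᴹ definingᴹ) ∧ (∃′ (∼ (∃′ (suc zero ≺ zero)) ∧ Θᴹ.rejection (_∋ zero)))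

  module _ (𝒜 : DataInstance) (ℓs : Vec (tem 𝒜) m) where
    open Instance 𝒜 ℓs

    sat-eqᴹ : ∀ {s v} E (e : Vec (tem 𝒜) v) t t′ →
              MSO-sat {s} 𝒜 E e (eqᴹ t t′) ⇔ proj₁ (lookup e t) ≡ proj₁ (lookup e t′)
    sat-eqᴹ E e t t′ = mk⇔
      (λ (¬lt , ¬gt) → ℤ.≤-antisym (ℤ.≮⇒≥ (¬gt ∘ lift)) (ℤ.≮⇒≥ (¬lt ∘ lift)))
      (λ eq → (λ (lift lt) → ℤ.<-irrefl eq lt) , (λ (lift gt) → ℤ.<-irrefl (sym eq) gt))

    module _ (E : Vec (tem 𝒜 → Set) N) where

      Holds : ℕ → Set
      Holds k = ∀ s b → lookup E s (+ k , b) ⇔ Run (suc k) s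

      -- Through `k ≡ suc k′` the premise is vacuous at time 0, so one statement serves both the
      -- base and the step of the induction.
      sat-previous : ∀ k (b : 0ℤ ≤ + k × + k ≤ max 𝒜) → (∀ k′ → k ≡ suc k′ → Holds k′) →
                     ∀ s → MSO-sat 𝒜 E ((+ k , b) ∷ ℓs) (previousᴹ s) ⇔ Run k s
      sat-previous zero b holds s = mk⇔
        (λ { ((+ _ , _) , lift (+<+ ()) , _) ; ((-[1+ _ ] , () , _) , _) }) (λ ())
      sat-previous (suc k) (_ , b) holds s = mk⇔
        (λ ((x , 0≤x , x≤max) , lift x<k , ¬between , lift Ex) → at-predecessor x 0≤x x≤max x<k
           (λ lt → ¬between ((sucℤ x , ℤ.≤-trans 0≤x (ℤ.i≤suc[i] x) ,
                              ℤ.≤-trans (ℤ.<⇒≤ lt) b) , lift (i<1+i x) , lift lt)) Ex)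
        (λ run → (+ k , bk) , lift (i<1+i (+ k)) ,
           (λ (_ , lift lt , lift lt′) → ℤ.<⇒≱ lt′ (ℤ.i<j⇒suc[i]≤j lt)) , lift (from (holds k refl s bk) run))
        where
        bk : 0ℤ ≤ + k × + k ≤ max 𝒜
        bk = +≤+ z≤n , ℤ.≤-trans (ℤ.i≤suc[i] (+ k)) b
        at-predecessor : ∀ x 0≤x x≤max → x < + suc k → ¬ sucℤ x < + suc k → lookup E s (x , 0≤x , x≤max) → Run (suc k) s
        at-predecessor x 0≤x x≤max x<k ¬lt Ex with adjacent x<k ¬lt
        at-predecessor (+ .k) 0≤x x≤max x<k ¬lt Ex | refl = to (holds k refl s _) Ex

      sat-nextᴹ : ∀ k (b : 0ℤ ≤ + k × + k ≤ max 𝒜) → (∀ k′ → k ≡ suc k′ → Holds k′) →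
               ∀ s → MSO-sat 𝒜 E ((+ k , b) ∷ ℓs) (nextᴹ s) ⇔ Run (suc k) s
      sat-nextᴹ k b holds = Θᴹ.Correctness.sat-transition (interpretsᴹ 𝒜 E e) X X-past M X-future
        k letterᴹ previousᴹ
        (λ i → column-⇔ (+ k , b) i ⇔-∘
          Shannon.Semantics.sat-letter connectivesᴹ (interpretsᴹ 𝒜 E e) (_▷ zero) (eqᴹ zero)
            (factsᴵ 𝒜) (λ z → proj₁ (lookup e z)) (+ k)
            (λ a → mk⇔ lower lift) (λ z → sat-eqᴹ E e zero z) (variables m) i)
        (sat-previous k b holds)
        where
        e : Vec (tem 𝒜) (suc m)
        e = (+ k , b) ∷ ℓs

      sat-rejectionᴹ : Holds M → ∀ t → proj₁ t ≡ + M →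
                       MSO-sat 𝒜 E (t ∷ ℓs) (Θᴹ.rejection (_∋ zero)) ⇔ (¬ Refutable q X)
      sat-rejectionᴹ holds (.(+ M) , b) refl = Θᴹ.Correctness.sat-rejection
        (interpretsᴹ 𝒜 E ((+ M , b) ∷ ℓs)) X X-past M X-future (_∋ zero)
        (λ s → holds s b ⇔-∘ mk⇔ lower lift)

      holds-all : MSO-sat 𝒜 E ℓs (∀′ (allᴹ definingᴹ)) → ∀ k → + k ≤ max 𝒜 → Holds k
      holds-all defn k k≤max s b = sat-nextᴹ k b before s ⇔-∘
          mk⇔ (λ x → proj₁ iff (lift x)) (λ y → lower (proj₂ iff y))
        where
        iff = to (sat-allᴹ 𝒜 E ((+ k , b) ∷ ℓs) definingᴹ) (defn (+ k , b)) s
        before : ∀ k′ → k ≡ suc k′ → Holds k′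
        before k′ refl = holds-all defn k′ (ℤ.≤-trans (ℤ.i≤suc[i] (+ k′)) k≤max)

    -- The witnesses for the set quantifiers: the times at which the prefix read so far, current
    -- letter included, has class `s`.
    run : Fin N → tem 𝒜 → Set
    run s (+ k      , _) = Run (suc k) s
    run s (-[1+ _ ] , _) = ⊥

    runs : Vec (tem 𝒜 → Set) N
    runs = tabulate run

    runs-hold : ∀ k → Holds runs k
    runs-hold k s b = ≡⇒⇔ (cong (λ (Y : tem 𝒜 → Set) → Y (+ k , b)) (lookup∘tabulate run s))

    matrixᴹ-⇔ : (∃[ E ] MSO-sat 𝒜 E ℓs matrixᴹ) ⇔ (¬ Refutable q X)
    matrixᴹ-⇔ = mk⇔
      (λ (E , defn , (t@(n , 0≤n , n≤max) , ¬next , rej)) →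
         to (sat-rejectionᴹ E (holds-all E defn M (subst (+ M ≤_) (sym max≡) ℤ.≤-refl)) t
               (trans (ℤ.≤-antisym n≤max (ℤ.≮⇒≥ (λ lt → ¬next (last , lift lt)))) max≡)) rej)
      (λ irr → runs , defined ,
         last , (λ ((_ , _ , u≤max) , lift max<u) → ℤ.<⇒≱ max<u u≤max) ,
         from (sat-rejectionᴹ runs (runs-hold M) last max≡) irr)
      where
      defined : ∀ t → MSO-sat 𝒜 runs (t ∷ ℓs) (allᴹ definingᴹ)
      defined (-[1+ _ ] , () , _)
      defined t@(+ k , b) = from (sat-allᴹ 𝒜 runs (t ∷ ℓs) definingᴹ) λ s →
        let Θ⇔ = sat-nextᴹ runs k b (λ k′ _ → runs-hold k′) s in
        (λ (lift x) → from Θ⇔ (to (runs-hold k s b) x)) , (λ y → lift (from (runs-hold k s b) (to Θ⇔ y)))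

    rewritingᴹ-correct : CertainAnswer q 𝒜 ℓs ⇔ MSO-sat 𝒜 [] ℓs (close N matrixᴹ)
    rewritingᴹ-correct = ⇔-sym (sat-close 𝒜 ℓs N matrixᴹ) ⇔-∘ (⇔-sym matrixᴹ-⇔ ⇔-∘ certain-⇔ q 𝒜 ℓs)

theorem27 : ExcludedMiddle (lsuc 0ℓ) →
    ∀ {m} (q : OMQ m) → FORPR-Rewritable q × MSO-Rewritable q
theorem27 em q = (rewritingᴿ , rewritingᴿ-correct) , (close N matrixᴹ , rewritingᴹ-correct)
  where open Rewriting em q
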